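{- Let $p$ be a prime and let $k\ge 2$ be an odd integer dividing $p-1$; write $p=km+1$. Let $0<\alpha_1<\alpha_2<\cdots<\alpha_m<p$ be all the $k$-th power residues modulo $p$ in the interval $(0,p)$, and let $$W_p(k)=\left[\left(\frac{\alpha_i+\alpha_j}{p}\right)\right]_{1\le i,j\le m},$$ where $\left(\frac{\cdot}{p}\right)$ is the Legendre symbol. Fix a primitive root $g$ modulo $p$ and define integers $c_p(k)$, $d_p(k)$ by $$p+1-c_p(k)=\#\{(x,y)\in\mathbb{F}_p\times\mathbb{F}_p:\ y^2=x(x^{2k}+1)\}+1,\qquad p+1-d_p(k)=\#\{(x,y)\in\mathbb{F}_p\times\mathbb{F}_p:\ y^2=x(x^{2k}+g^k)\}+1.$$ Then: (i) If $p\equiv 1\pmod 4$, then $\det W_p(k)=\frac{z_p(k)^2}{4k^2}\left(c_p(k)^2+d_p(k)^2\right)$ for some $z_p(k)\in\mathbb{Z}$. (ii) If $p\equiv 3\pmod 4$, then $-\det W_p(k)$ is the square of an integer.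
   Context: $\mathbb{F}_p$ denotes the finite field with $p$ elements. An integer $\alpha$ with $p\nmid\alpha$ is a $k$-th power residue modulo $p$ if $\alpha\equiv x^k\pmod p$ for some integer $x$. The "+1" in the definitions of $c_p(k)$, $d_p(k)$ accounts for a single point at infinity added to the affine points. -}

module Defs where

open import Data.Nat as ℕ using (ℕ; zero; suc; _^_; _*_; _+_; _∸_)
open import Data.Nat.DivMod using (_%_)
open import Data.Bool using (Bool; true; false; if_then_else_)
open import Data.Fin using (Fin; toℕ; punchIn)
import Data.Fin as Fin
open import Data.List using (List; []; _∷_; filter; length; lookup; upTo; applyUpTo)
open import Data.List.Relation.Unary.Any using (any?)
open import Data.Integer as ℤ using (ℤ; +_; -_)
open import Relation.Nullary using (does)
open import Relation.Binary.PropositionalEquality using (_≡_; _≢_)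
open import Data.Product using (_×_)

-- reduction modulo p on naturals (p = 0 never occurs in the theorem since p is prime)
mod : ℕ → ℕ → ℕ
mod zero    a = a
mod (suc n) a = a % suc n

-- a is a k-th power residue modulo p: a ≡ x^k (mod p) for some integer x.
-- Since x^k mod p only depends on x mod p, searching x ∈ [0,p) is exhaustive.
isKthPowerResidue : ℕ → ℕ → ℕ → Bool
isKthPowerResidue p k a = does (any? (λ x → mod p (x ^ k) ℕ.≟ mod p a) (upTo p))

kthResidues : ℕ → ℕ → List ℕ
kthResidues p k = filter (λ a → isKthPowerResidue p k a Data.Bool.≟ true) (applyUpTo suc (p ∸ 1))

legendre : ℕ → ℕ → ℤ
legendre p a =
  if does (mod p a ℕ.≟ 0) then + 0
  else if does (any? (λ x → mod p (x * x) ℕ.≟ mod p a) (upTo p)) then + 1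
  else - (+ 1)

sumFin : ∀ n → (Fin n → ℤ) → ℤ
sumFin zero    f = + 0
sumFin (suc n) f = f Fin.zero ℤ.+ sumFin n (λ i → f (Fin.suc i))

sign : ℕ → ℤ
sign zero          = + 1
sign (suc zero)    = - (+ 1)
sign (suc (suc n)) = sign n

det : ∀ n → (Fin n → Fin n → ℤ) → ℤ
det zero    M = + 1
det (suc n) M =
  sumFin (suc n) (λ j → sign (toℕ j) ℤ.* M Fin.zero j ℤ.* det n (λ r c → M (Fin.suc r) (punchIn j c)))

dimW : ℕ → ℕ → ℕ
dimW p k = length (kthResidues p k)

W : (p k : ℕ) → Fin (dimW p k) → Fin (dimW p k) → ℤ
W p k i j = legendre p (lookup (kthResidues p k) i + lookup (kthResidues p k) j)

countPairs : ℕ → (ℕ → ℕ → Bool) → ℕ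
countPairs p P = go p
  where
  row : ℕ → ℕ → ℕ
  row x zero    = 0
  row x (suc y) = (if P x y then 1 else 0) + row x y
  go : ℕ → ℕ
  go zero    = 0
  go (suc x) = row x p + go x

affinePoints : (p k b : ℕ) → ℕ
affinePoints p k b = countPairs p (λ x y → does (mod p (y * y) ℕ.≟ mod p (x * (x ^ (2 * k) + b))))

-- c_p(k), d_p(k) defined by  p + 1 - c = #affine + 1,  i.e.  c = p - #affine
cp : (p k : ℕ) → ℤ
cp p k = + p ℤ.- + affinePoints p k 1

dp : (p k g : ℕ) → ℤ
dp p k g = + p ℤ.- + affinePoints p k (g ^ k)

IsPrimitiveRoot : ℕ → ℕ → Set
IsPrimitiveRoot p g =
  (mod p (g ^ (p ∸ 1)) ≡ mod p 1) × (∀ e → 1 ℕ.≤ e → e ℕ.< p ∸ 1 → mod p (g ^ e) ≢ mod p 1)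

{-# OPTIONS --safe #-}
module Submission where

-- With h = g ^ k the residues are the powers of h, so up to a simultaneous permutation of rows
-- and columns W is M i j = χ (h ^ i + h ^ j), χ the Legendre symbol.  Since χ h = -1, M is symmetric with
-- M (i + 1) (j + 1) = - M i j, and m = 2 r is even.
--
-- If r is odd, rotating the rows by r (a permutation of sign -1) makes M skew-symmetric, and a
-- skew-symmetric integer matrix of even size has a square determinant.
--
-- If r is even, the plane spanned by the real and imaginary parts of (𝕚 ^ j) is invariant under M,
-- which acts on it with determinant -(A² + B²), where A + B 𝕚 = Σ 𝕚 ^ j M 0 j.
-- The operator T² + 1 (T the cyclic shift) identifies the quotient by that plane with its
-- annihilator and turns M into a skew-symmetric form on the quotient.  Concretely, adding row
-- i + 2 to row i (for i ≥ 2, after a rotation by one step) and combining the columns 0 and 1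
-- with the powers of 𝕚 yields a block triangular matrix with a 2 × 2 block of determinant
-- -(A² + B²) and a skew-symmetric block.  Finally, parametrising x by the powers of g gives
-- c = -2kA and d = -2kB.

open import Defs

-- After the rotation, `N i j` equals `M (i + 1) j - M i (j + 1)`, which changes sign when i and j
-- are exchanged because `M` is symmetric: this is the source of the skew form. T² + 1 kills exactly
-- the plane of the powers of 𝕚, so it can replace only m - 2 rows without losing the determinant,
-- and the two rows kept account for the 2 × 2 block. That 𝕚 ^ j is periodic modulo m is where 4 ∣ m
-- enters.
--
-- Every operation of this step has determinant ±1, so the factor next to A² + B² is an integer
-- square. Only the theorem on skew determinants needs a division: elimination without fractions
-- shows that the determinant times a square is a square, and a divisibility argument removes the
-- factor inside ℤ.
--
-- Both curves see x only through χ(x) and x ^ 2k, hence only even powers of h. A shift by one turns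
-- odd exponents into even ones, so B is the real part of the same sum taken in row 1; this is how
-- the coefficient g ^ k of the second curve arises. The factor 2k counts the periods of length m /
-- 2 among the p - 1 exponents.

module Determinants where
  open import Data.Nat.Base as ℕ using (ℕ; zero; suc; _<_; _≤_)
  import Data.Nat.Properties as ℕ
  import Data.Nat.Divisibility as ℕ
  open import Data.Nat.GCD using (gcd; gcd[m,n]∣m; gcd[m,n]∣n; gcd-greatest; gcd[m,n]≢0)
  open import Data.Nat.Coprimality using (Coprime; coprime-divisor)
  open import Data.Nat.Tactic.RingSolver using () renaming (solve-∀ to solve-∀-ℕ)
  open import Data.Fin.Base using (Fin; zero; suc; toℕ; fromℕ; fromℕ<; inject₁; punchIn)
  import Data.Fin.Properties as Fin
  open import Data.Fin.Permutation as Permutation using (Permutation; _⟨$⟩ʳ_)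
  import Data.Fin.Permutation.Components as Components
  open import Data.Fin.Permutation.Transposition.List using (TranspositionList; eval; decompose; eval-decompose)
  open import Data.Integer as ℤ using (ℤ; -_; _+_; _*_; _-_; _^_; 0ℤ; 1ℤ; -1ℤ; ∣_∣)
  open import Data.Integer.Properties
  import Data.Integer.Divisibility.Signed as ℤ
  open import Data.Integer.Tactic.RingSolver using (solve-∀)
  open import Algebra.Properties.AbelianGroup +-0-abelianGroup using (∙-cancelʳ)
  open import Data.Bool.Base using (if_then_else_)
  open import Data.List.Base using ([]; _∷_)
  open import Data.Product using (_,_; ∃)
  open import Data.Sum using (inj₁)
  open import Data.Vec.Functional using (updateAt)
  open import Data.Vec.Functional.Properties using (updateAt-updates; updateAt-minimal)
  open import Function using (_∘_; const)
  open import Relation.Nullary using (yes; no; does; contradiction)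
  open import Relation.Nullary.Decidable using (dec-true; dec-false)
  open import Relation.Binary.PropositionalEquality

  -- Determinants over ℤ

  Matrix : ℕ → Set
  Matrix n = Fin n → Fin n → ℤ

  infix 4 _≈_
  _≈_ : ∀ {n} → Matrix n → Matrix n → Set
  M ≈ N = ∀ i j → M i j ≡ N i j

  transpose : ∀ {n} → Matrix n → Matrix n
  transpose M i j = M j i

  minor : ∀ {n} → Fin (suc n) → Fin (suc n) → Matrix (suc n) → Matrix n
  minor i j M r c = M (punchIn i r) (punchIn j c)

  sumFin-cong : ∀ n {f g : Fin n → ℤ} → (∀ i → f i ≡ g i) → sumFin n f ≡ sumFin n g
  sumFin-cong zero    f≡g = refl
  sumFin-cong (suc n) f≡g = cong₂ _+_ (f≡g zero) (sumFin-cong n (f≡g ∘ suc))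

  sumFin-zero : ∀ n {f : Fin n → ℤ} → (∀ i → f i ≡ 0ℤ) → sumFin n f ≡ 0ℤ
  sumFin-zero zero    f≡0 = refl
  sumFin-zero (suc n) f≡0 = cong₂ _+_ (f≡0 zero) (sumFin-zero n (f≡0 ∘ suc))

  sumFin-linear : ∀ n x y (f g : Fin n → ℤ) →
    sumFin n (λ i → x * f i + y * g i) ≡ x * sumFin n f + y * sumFin n g
  sumFin-linear zero    x y f g = (solve x y)
    where
    solve : ∀ x y → 0ℤ ≡ x * 0ℤ + y * 0ℤ
    solve = solve-∀
  sumFin-linear (suc n) x y f g
    rewrite sumFin-linear n x y (f ∘ suc) (g ∘ suc) = solve x y (f zero) (g zero) _ _
    where
    solve : ∀ x y a b s t → x * a + y * b + (x * s + y * t) ≡ x * (a + s) + y * (b + t)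
    solve = solve-∀

  *-sumFin : ∀ n x (f : Fin n → ℤ) → sumFin n (λ i → x * f i) ≡ x * sumFin n f
  *-sumFin zero    x f = sym (*-zeroʳ x)
  *-sumFin (suc n) x f =
    trans (cong (x * f zero +_) (*-sumFin n x (f ∘ suc))) (sym (*-distribˡ-+ x (f zero) _))

  sumFin-+ : ∀ n (f g : Fin n → ℤ) → sumFin n (λ i → f i + g i) ≡ sumFin n f + sumFin n g
  sumFin-+ zero    f g = refl
  sumFin-+ (suc n) f g rewrite sumFin-+ n (f ∘ suc) (g ∘ suc) = solve (f zero) (g zero) _ _
    where
    solve : ∀ a b s t → a + b + (s + t) ≡ a + s + (b + t)
    solve = solve-∀

  sumFin-swap : ∀ m n (f : Fin m → Fin n → ℤ) →
    sumFin m (λ i → sumFin n (f i)) ≡ sumFin n (λ j → sumFin m (λ i → f i j))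
  sumFin-swap zero    n f = sym (sumFin-zero n (λ _ → refl))
  sumFin-swap (suc m) n f = trans
    (cong (sumFin n (f zero) +_) (sumFin-swap m n (f ∘ suc)))
    (sym (sumFin-+ n (f zero) (λ j → sumFin m (λ i → f (suc i) j))))

  sign-suc : ∀ n → sign (suc n) ≡ - sign n
  sign-suc zero          = refl
  sign-suc (suc zero)    = refl
  sign-suc (suc (suc n)) = sign-suc n

  term : ∀ n → Matrix (suc n) → Fin (suc n) → ℤ
  term n M j = sign (toℕ j) * M zero j * det n (minor zero j M)

  term₀ : ∀ n → Matrix (suc n) → Fin (suc n) → ℤ
  term₀ n M i = sign (toℕ i) * M i zero * det n (minor i zero M)

  det-cong : ∀ n {M N : Matrix n} → M ≈ N → det n M ≡ det n N
  det-cong zero    M≈N = refl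
  det-cong (suc n) M≈N = sumFin-cong (suc n) λ j →
    cong₂ _*_ (cong (sign (toℕ j) *_) (M≈N zero j)) (det-cong n λ r c → M≈N (suc r) (punchIn j c))

  -- The two expansions share the (0,0) term. Elsewhere, each first-row minor is expanded along its
  -- first column by induction; after exchanging the two sums, the inner sum is by definition the
  -- first-row expansion of a first-column minor.
  det-expand₀ : ∀ n (M : Matrix (suc n)) →
    det (suc n) M ≡ sumFin (suc n) (term₀ n M)
  det-expand₀ zero    M = refl
  det-expand₀ (suc n) M = cong (term (suc n) M zero +_) (begin
    sumFin (suc n) (λ j → sign (suc (toℕ j)) * M zero (suc j) * det (suc n) (minor zero (suc j) M))
      ≡⟨ sumFin-cong (suc n) (λ j → trans
           (cong (sign (suc (toℕ j)) * M zero (suc j) *_) (det-expand₀ n (minor zero (suc j) M)))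
           (sym (*-sumFin (suc n) (sign (suc (toℕ j)) * M zero (suc j)) (term₀ n (minor zero (suc j) M))))) ⟩
    sumFin (suc n) (λ j → sumFin (suc n) (λ i →
      sign (suc (toℕ j)) * M zero (suc j) * (sign (toℕ i) * M (suc i) zero * D i j)))
      ≡⟨ sumFin-swap (suc n) (suc n) (λ j i →
           sign (suc (toℕ j)) * M zero (suc j) * (sign (toℕ i) * M (suc i) zero * D i j)) ⟩
    sumFin (suc n) (λ i → sumFin (suc n) (λ j →
      sign (suc (toℕ j)) * M zero (suc j) * (sign (toℕ i) * M (suc i) zero * D i j)))
      ≡⟨ sumFin-cong (suc n) (λ i → sumFin-cong (suc n) (λ j → exchange i j)) ⟩
    sumFin (suc n) (λ i → sumFin (suc n) (λ j →
      sign (suc (toℕ i)) * M (suc i) zero * (sign (toℕ j) * M zero (suc j) * D i j)))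
      ≡⟨ sumFin-cong (suc n) (λ i →
           *-sumFin (suc n) (sign (suc (toℕ i)) * M (suc i) zero) (term n (minor (suc i) zero M))) ⟩
    sumFin (suc n) (λ i → sign (suc (toℕ i)) * M (suc i) zero * det (suc n) (minor (suc i) zero M)) ∎)
    where
    open ≡-Reasoning
    D : Fin (suc n) → Fin (suc n) → ℤ
    D i j = det n (λ r c → M (suc (punchIn i r)) (suc (punchIn j c)))
    solve : ∀ s t a b d → - s * a * (t * b * d) ≡ - t * b * (s * a * d)
    solve = solve-∀
    exchange : ∀ i j →
      sign (suc (toℕ j)) * M zero (suc j) * (sign (toℕ i) * M (suc i) zero * D i j) ≡
      sign (suc (toℕ i)) * M (suc i) zero * (sign (toℕ j) * M zero (suc j) * D i j)
    exchange i j rewrite sign-suc (toℕ j) | sign-suc (toℕ i) =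
      solve (sign (toℕ j)) (sign (toℕ i)) (M zero (suc j)) (M (suc i) zero) (D i j)

  det-transpose : ∀ n (M : Matrix n) → det n (transpose M) ≡ det n M
  det-transpose zero    M = refl
  det-transpose (suc n) M = trans
    (sumFin-cong (suc n) (λ j → cong (sign (toℕ j) * M j zero *_) (det-transpose n (minor j zero M))))
    (sym (det-expand₀ n M))

  -- Phrased for three matrices that agree pointwise off row `r`, so that the hypotheses pass to
  -- minors without function extensionality.
  det-linear : ∀ n (r : Fin n) x y {M U V : Matrix n} →
    (∀ i → i ≢ r → ∀ j → M i j ≡ U i j) → (∀ i → i ≢ r → ∀ j → M i j ≡ V i j) →
    (∀ j → M r j ≡ x * U r j + y * V r j) →
    det n M ≡ x * det n U + y * det n V
  det-linear (suc n) zero x y {M} {U} {V} M≡U M≡V Mr = trans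
    (sumFin-cong (suc n) λ j → begin
      sign (toℕ j) * M zero j * det n (minor zero j M)
        ≡⟨ cong (λ a → sign (toℕ j) * a * det n (minor zero j M)) (Mr j) ⟩
      sign (toℕ j) * (x * U zero j + y * V zero j) * det n (minor zero j M)
        ≡⟨ solve x y (sign (toℕ j)) (U zero j) (V zero j) _ ⟩
      x * (sign (toℕ j) * U zero j * det n (minor zero j M)) +
      y * (sign (toℕ j) * V zero j * det n (minor zero j M))
        ≡⟨ cong₂ (λ d e → x * (sign (toℕ j) * U zero j * d) + y * (sign (toℕ j) * V zero j * e))
             (det-cong n (λ i c → M≡U (suc i) (λ ()) (punchIn j c)))
             (det-cong n (λ i c → M≡V (suc i) (λ ()) (punchIn j c))) ⟩
      x * (sign (toℕ j) * U zero j * det n (minor zero j U)) +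
      y * (sign (toℕ j) * V zero j * det n (minor zero j V)) ∎)
    (sumFin-linear (suc n) x y (term n U) (term n V))
    where
    open ≡-Reasoning
    solve : ∀ x y s u v d → s * (x * u + y * v) * d ≡ x * (s * u * d) + y * (s * v * d)
    solve = solve-∀
  det-linear (suc n) (suc r) x y {M} {U} {V} M≡U M≡V Mr = trans
    (sumFin-cong (suc n) λ j → begin
      sign (toℕ j) * M zero j * det n (minor zero j M)
        ≡⟨ cong (sign (toℕ j) * M zero j *_) (det-linear n r x y
             (λ i i≢r c → M≡U (suc i) (i≢r ∘ Fin.suc-injective) (punchIn j c))
             (λ i i≢r c → M≡V (suc i) (i≢r ∘ Fin.suc-injective) (punchIn j c))
             (λ c → Mr (punchIn j c))) ⟩
      sign (toℕ j) * M zero j * (x * det n (minor zero j U) + y * det n (minor zero j V))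
        ≡⟨ solve x y (sign (toℕ j)) (M zero j) _ _ ⟩
      x * (sign (toℕ j) * M zero j * det n (minor zero j U)) +
      y * (sign (toℕ j) * M zero j * det n (minor zero j V))
        ≡⟨ cong₂ (λ a b → x * (sign (toℕ j) * a * det n (minor zero j U)) +
                          y * (sign (toℕ j) * b * det n (minor zero j V)))
             (M≡U zero (λ ()) j) (M≡V zero (λ ()) j) ⟩
      x * (sign (toℕ j) * U zero j * det n (minor zero j U)) +
      y * (sign (toℕ j) * V zero j * det n (minor zero j V)) ∎)
    (sumFin-linear (suc n) x y (term n U) (term n V))
    where
    open ≡-Reasoning
    solve : ∀ x y s m d e → s * m * (x * d + y * e) ≡ x * (s * m * d) + y * (s * m * e)
    solve = solve-∀

  -- Exchanging rows.

  swap₀₁ : ∀ {n} → Fin (suc (suc n)) → Fin (suc (suc n))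
  swap₀₁ zero          = suc zero
  swap₀₁ (suc zero)    = zero
  swap₀₁ (suc (suc i)) = suc (suc i)

  neg-sumFin : ∀ n (f : Fin n → ℤ) → sumFin n (λ i → - f i) ≡ - sumFin n f
  neg-sumFin zero    f = refl
  neg-sumFin (suc n) f =
    trans (cong (- f zero +_) (neg-sumFin n (f ∘ suc))) (sym (neg-distrib-+ (f zero) _))

  -- In the expansion along the first column, the terms of rows 0 and 1 trade places and have
  -- opposite signs. Every other minor still contains both rows and changes sign by induction.
  det-swap₀₁ : ∀ n (M : Matrix (suc (suc n))) → det (suc (suc n)) (M ∘ swap₀₁) ≡ - det (suc (suc n)) M
  det-swap₀₁ n M = begin
    det (2 ℕ.+ n) M′
      ≡⟨ det-expand₀ (suc n) M′ ⟩
    term₀ (suc n) M′ zero + (term₀ (suc n) M′ (suc zero) + sumFin n (λ i → term₀ (suc n) M′ (suc (suc i))))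
      ≡⟨ cong (λ s → term₀ (suc n) M′ zero + (term₀ (suc n) M′ (suc zero) + s))
           (trans (sumFin-cong n tail) (neg-sumFin n (λ i → term₀ (suc n) M (suc (suc i))))) ⟩
    term₀ (suc n) M′ zero + (term₀ (suc n) M′ (suc zero) + - sumFin n (λ i → term₀ (suc n) M (suc (suc i))))
      ≡⟨ cong₂ (λ s t → s + (t + - sumFin n (λ i → term₀ (suc n) M (suc (suc i)))))
           (cong (1ℤ * M (suc zero) zero *_) (det-cong (suc n) first))
           (cong (-1ℤ * M zero zero *_) (det-cong (suc n) second)) ⟩
    1ℤ * M (suc zero) zero * det (suc n) (minor (suc zero) zero M) +
    (-1ℤ * M zero zero * det (suc n) (minor zero zero M) + - sumFin n (λ i → term₀ (suc n) M (suc (suc i))))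
      ≡⟨ solve (M (suc zero) zero) (M zero zero) _ _ _ ⟩
    - (term₀ (suc n) M zero + (term₀ (suc n) M (suc zero) + sumFin n (λ i → term₀ (suc n) M (suc (suc i)))))
      ≡⟨ cong -_ (sym (det-expand₀ (suc n) M)) ⟩
    - det (2 ℕ.+ n) M ∎
    where
    open ≡-Reasoning
    M′ = M ∘ swap₀₁
    solve : ∀ a b d e s → 1ℤ * a * d + (-1ℤ * b * e + - s) ≡ - (1ℤ * b * e + (-1ℤ * a * d + s))
    solve = solve-∀
    first : minor zero zero M′ ≈ minor (suc zero) zero M
    first zero    c = refl
    first (suc r) c = refl
    second : minor (suc zero) zero M′ ≈ minor zero zero M
    second zero    c = refl
    second (suc r) c = refl
    tail : ∀ i → term₀ (suc n) M′ (suc (suc i)) ≡ - term₀ (suc n) M (suc (suc i))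
    tail i = trans (cong (sign (toℕ i) * M (suc (suc i)) zero *_) (minor-swap n i M))
                   (sym (neg-distribʳ-* (sign (toℕ i) * M (suc (suc i)) zero) _))
      where
      minor-swap : ∀ n (i : Fin n) (M : Matrix (2 ℕ.+ n)) →
        det (suc n) (minor (suc (suc i)) zero (M ∘ swap₀₁)) ≡ - det (suc n) (minor (suc (suc i)) zero M)
      minor-swap (suc n) i M = trans
        (det-cong (2 ℕ.+ n) {minor (suc (suc i)) zero (M ∘ swap₀₁)} {minor (suc (suc i)) zero M ∘ swap₀₁}
          λ { zero c → refl ; (suc zero) c → refl ; (suc (suc r)) c → refl })
        (det-swap₀₁ n (minor (suc (suc i)) zero M))

  -- A relation instead of an operation on matrices: it restricts to minors and survives conjugation
  -- by pointwise arguments alone.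
  record Swapped {n} (i j : Fin n) (M N : Matrix n) : Set where
    field
      rowᵢ : ∀ c → N i c ≡ M j c
      rowⱼ : ∀ c → N j c ≡ M i c
      rest : ∀ k → k ≢ i → k ≢ j → ∀ c → N k c ≡ M k c

  Swapped-sym : ∀ {n} {i j : Fin n} {M N} → Swapped i j M N → Swapped j i M N
  Swapped-sym s = record { rowᵢ = rowⱼ ; rowⱼ = rowᵢ ; rest = λ k k≢j k≢i → rest k k≢i k≢j }
    where open Swapped s

  det-swap : ∀ n {i j : Fin n} {M N : Matrix n} → i ≢ j → Swapped i j M N → det n N ≡ - det n M
  det-swap-suc : ∀ n {i j : Fin n} {M N : Matrix (suc n)} → i ≢ j → Swapped (suc i) (suc j) M N →
    det (suc n) N ≡ - det (suc n) M
  det-swap-zero : ∀ n {j : Fin n} {M N : Matrix (suc n)} → Swapped zero (suc j) M N →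
    det (suc n) N ≡ - det (suc n) M

  det-swap (suc n) {zero}  {zero}  i≢j s = contradiction refl i≢j
  det-swap (suc n) {zero}  {suc j} i≢j s = det-swap-zero n s
  det-swap (suc n) {suc i} {zero}  i≢j s = det-swap-zero n (Swapped-sym s)
  det-swap (suc n) {suc i} {suc j} i≢j s = det-swap-suc n (i≢j ∘ cong suc) s

  det-swap-suc n {i} {j} {M} {N} i≢j s = trans
    (sumFin-cong (suc n) λ c → trans
      (cong₂ _*_ (cong (sign (toℕ c) *_) (rest zero (λ ()) (λ ()) c))
        (det-swap n i≢j record
          { rowᵢ = λ d → rowᵢ (punchIn c d)
          ; rowⱼ = λ d → rowⱼ (punchIn c d)
          ; rest = λ k k≢i k≢j d →
              rest (suc k) (k≢i ∘ Fin.suc-injective) (k≢j ∘ Fin.suc-injective) (punchIn c d) }))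
      (sym (neg-distribʳ-* (sign (toℕ c) * M zero c) (det n (minor zero c M)))))
    (neg-sumFin (suc n) (term n M))
    where open Swapped s

  det-swap-zero (suc n) {zero} {M} {N} s = trans (det-cong (2 ℕ.+ n) N≈) (det-swap₀₁ n M)
    where
    open Swapped s
    N≈ : N ≈ M ∘ swap₀₁
    N≈ zero          = rowᵢ
    N≈ (suc zero)    = rowⱼ
    N≈ (suc (suc k)) = rest (suc (suc k)) (λ ()) (λ ())
  -- (0 j) is conjugate to (1 j) by (0 1).
  det-swap-zero (suc n) {suc j} {M} {N} s = begin
    det (2 ℕ.+ n) N                ≡⟨ neg-involutive _ ⟨
    - - det (2 ℕ.+ n) N            ≡⟨ cong -_ (det-swap₀₁ n N) ⟨
    - det (2 ℕ.+ n) (N ∘ swap₀₁)   ≡⟨ cong -_ (det-swap-suc (suc n) (λ ()) conjugate) ⟩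
    - - det (2 ℕ.+ n) (M ∘ swap₀₁) ≡⟨ neg-involutive _ ⟩
    det (2 ℕ.+ n) (M ∘ swap₀₁)     ≡⟨ det-swap₀₁ n M ⟩
    - det (2 ℕ.+ n) M              ∎
    where
    open ≡-Reasoning
    open Swapped s
    conjugate : Swapped (suc zero) (suc (suc j)) (M ∘ swap₀₁) (N ∘ swap₀₁)
    conjugate .Swapped.rowᵢ = rowᵢ
    conjugate .Swapped.rowⱼ = rowⱼ
    conjugate .Swapped.rest zero          _   _   = rest (suc zero) (λ ()) (λ ())
    conjugate .Swapped.rest (suc zero)    1≢1 _   = contradiction refl 1≢1
    conjugate .Swapped.rest (suc (suc k)) _   k≢j = rest (suc (suc k)) (λ ()) k≢j

  i≡-i⇒i≡0 : ∀ i → i ≡ - i → i ≡ 0ℤ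
  i≡-i⇒i≡0 (ℤ.+_ zero)    _ = refl
  i≡-i⇒i≡0 (ℤ.+_ (suc n))  ()
  i≡-i⇒i≡0 (ℤ.-[1+_] n)   ()

  det-equal-rows : ∀ n {i j : Fin n} (M : Matrix n) → i ≢ j → (∀ c → M i c ≡ M j c) → det n M ≡ 0ℤ
  det-equal-rows n M i≢j Mᵢ≡Mⱼ = i≡-i⇒i≡0 _ (det-swap n i≢j record
    { rowᵢ = Mᵢ≡Mⱼ ; rowⱼ = λ c → sym (Mᵢ≡Mⱼ c) ; rest = λ _ _ _ _ → refl })

  -- Linearity in a single row.

  infixl 6 _[_]≔_
  _[_]≔_ : ∀ {n} → Matrix n → Fin n → (Fin n → ℤ) → Matrix n
  M [ r ]≔ v = updateAt M r (const v)

  ≔-updates : ∀ {n} (M : Matrix n) r v j → (M [ r ]≔ v) r j ≡ v j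
  ≔-updates M r v j = cong (λ row → row j) (updateAt-updates r M)

  ≔-minimal : ∀ {n} (M : Matrix n) {r i} v → i ≢ r → ∀ j → (M [ r ]≔ v) i j ≡ M i j
  ≔-minimal M {r} {i} v i≢r j = cong (λ row → row j) (updateAt-minimal i r M i≢r)

  ≈-≔ : ∀ {n} {M N : Matrix n} r {v} → (∀ i → i ≢ r → ∀ j → N i j ≡ M i j) → (∀ j → N r j ≡ v j) → N ≈ M [ r ]≔ v
  ≈-≔ {M = M} r {v} off on i j with i Fin.≟ r
  ... | yes refl = trans (on j) (sym (≔-updates M r v j))
  ... | no  i≢r  = trans (off i i≢r j) (sym (≔-minimal M v i≢r j))

  det-≔-linear : ∀ {n} (M : Matrix n) r x y u v →
    det n (M [ r ]≔ (λ j → x * u j + y * v j)) ≡ x * det n (M [ r ]≔ u) + y * det n (M [ r ]≔ v)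
  det-≔-linear {n} M r x y u v = det-linear n r x y (agree u) (agree v) (λ j → trans (≔-updates M r _ j)
    (sym (cong₂ (λ a b → x * a + y * b) (≔-updates M r u j) (≔-updates M r v j))))
    where
    agree : ∀ w i → i ≢ r → ∀ j → (M [ r ]≔ (λ j → x * u j + y * v j)) i j ≡ (M [ r ]≔ w) i j
    agree w i i≢r j = trans (≔-minimal M _ i≢r j) (sym (≔-minimal M w i≢r j))

  det-≔-cong : ∀ {n} (M : Matrix n) r {u v} → (∀ j → u j ≡ v j) → det n (M [ r ]≔ u) ≡ det n (M [ r ]≔ v)
  det-≔-cong {n} M r u≡v = det-cong n (≈-≔ r (λ i i≢r → ≔-minimal M _ i≢r)
    (λ j → trans (≔-updates M r _ j) (u≡v j)))

  det-≔-sum : ∀ {n} (M : Matrix n) r l (c : Fin l → ℤ) (V : Fin l → Fin n → ℤ) →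
    det n (M [ r ]≔ (λ j → sumFin l (λ s → c s * V s j))) ≡ sumFin l (λ s → c s * det n (M [ r ]≔ V s))
  det-≔-sum {n} M r zero    c V = det-linear n r 0ℤ 0ℤ {U = M} {V = M} (λ _ → ≔-minimal M _) (λ _ → ≔-minimal M _) (≔-updates M r _)
  det-≔-sum {n} M r (suc l) c V = begin
    det n (M [ r ]≔ (λ j → c zero * V zero j + S j))
      ≡⟨ det-≔-cong M r (λ j → cong (c zero * V zero j +_) (sym (*-identityˡ (S j)))) ⟩
    det n (M [ r ]≔ (λ j → c zero * V zero j + 1ℤ * S j))
      ≡⟨ det-≔-linear M r (c zero) 1ℤ (V zero) S ⟩
    c zero * det n (M [ r ]≔ V zero) + 1ℤ * det n (M [ r ]≔ S)
      ≡⟨ cong (c zero * det n (M [ r ]≔ V zero) +_) (trans (*-identityˡ (det n (M [ r ]≔ S))) (det-≔-sum M r l (c ∘ suc) (V ∘ suc))) ⟩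
    sumFin (suc l) (λ s → c s * det n (M [ r ]≔ V s)) ∎
    where
    open ≡-Reasoning
    S : Fin n → ℤ
    S j = sumFin l (λ s → c (suc s) * V (suc s) j)

  det-≔-row : ∀ {n} (M : Matrix n) {r s} → s ≢ r → det n (M [ r ]≔ M s) ≡ 0ℤ
  det-≔-row {n} M {r} {s} s≢r = det-equal-rows n (M [ r ]≔ M s) s≢r
    (λ c → trans (≔-minimal M _ s≢r c) (sym (≔-updates M r _ c)))

  det-≔-self : ∀ {n} (M : Matrix n) r → det n (M [ r ]≔ M r) ≡ det n M
  det-≔-self {n} M r = sym (det-cong n (≈-≔ r (λ _ _ _ → refl) (λ _ → refl)))

  sumFin-single : ∀ n (r : Fin n) {f : Fin n → ℤ} → (∀ i → i ≢ r → f i ≡ 0ℤ) → sumFin n f ≡ f r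
  sumFin-single (suc n) zero    {f} f≡0 = trans (cong (f zero +_) (sumFin-zero n (λ i → f≡0 (suc i) (λ ())))) (+-identityʳ _)
  sumFin-single (suc n) (suc r) {f} f≡0 = trans
    (cong₂ _+_ (f≡0 zero (λ ())) (sumFin-single n r (λ i i≢r → f≡0 (suc i) (i≢r ∘ Fin.suc-injective))))
    (+-identityˡ _)

  -- By linearity every row `s ≢ r` contributes a determinant with two equal rows, so only the
  -- coefficient of row `r` itself survives.
  det-combine-rows : ∀ {n} (M : Matrix n) r (c : Fin n → ℤ) →
    det n (M [ r ]≔ (λ j → sumFin n (λ s → c s * M s j))) ≡ c r * det n M
  det-combine-rows {n} M r c = begin
    det n (M [ r ]≔ (λ j → sumFin n (λ s → c s * M s j)))
      ≡⟨ det-≔-sum M r n c M ⟩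
    sumFin n (λ s → c s * det n (M [ r ]≔ M s))
      ≡⟨ sumFin-single n r (λ s s≢r → trans (cong (c s *_) (det-≔-row M s≢r)) (*-zeroʳ (c s))) ⟩
    c r * det n (M [ r ]≔ M r)
      ≡⟨ cong (c r *_) (det-≔-self M r) ⟩
    c r * det n M ∎
    where open ≡-Reasoning

  det-zero-row : ∀ n (r : Fin n) (M : Matrix n) → (∀ j → M r j ≡ 0ℤ) → det n M ≡ 0ℤ
  -- A zero row is `0ℤ * M r j + 0ℤ * M r j`, and both this and the resulting combination of
  -- determinants compute to `0ℤ`.
  det-zero-row n r M = det-linear n r 0ℤ 0ℤ {U = M} {V = M} (λ _ _ _ → refl) (λ _ _ _ → refl)

  -- Rotations and simultaneous permutations of rows and columns.

  record Rotated {n} (M N : Matrix (suc n)) : Set where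
    field
      init : ∀ i c → N (inject₁ i) c ≡ M (suc i) c
      last : ∀ c → N (fromℕ n) c ≡ M zero c

  -- The sign is that of a cycle of length n + 1. Once rows 0 and 1 of `M` are exchanged, row 0 is
  -- in place and the rows below it differ from those of `N` by a rotation of length one less, which
  -- holds in every first-row minor.
  det-rotate : ∀ n {M N : Matrix (suc n)} → Rotated M N → det (suc n) N ≡ sign n * det (suc n) M
  det-rotate zero {M} {N} ρ = trans (det-cong 1 {N} {M} λ { zero → last }) (sym (*-identityˡ (det 1 M)))
    where open Rotated ρ
  det-rotate (suc n) {M} {N} ρ = begin
    det (2 ℕ.+ n) N
      ≡⟨ sumFin-cong (2 ℕ.+ n) (λ j → cong₂ _*_ (cong (sign (toℕ j) *_) (init zero j)) (det-rotate n (minors j))) ⟩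
    sumFin (2 ℕ.+ n) (λ j → sign (toℕ j) * M (suc zero) j * (sign n * det (suc n) (minor zero j (M ∘ swap₀₁))))
      ≡⟨ sumFin-cong (2 ℕ.+ n) (λ j → solve (sign (toℕ j)) (M (suc zero) j) (sign n)
           (det (suc n) (minor zero j (M ∘ swap₀₁)))) ⟩
    sumFin (2 ℕ.+ n) (λ j → sign n * (sign (toℕ j) * M (suc zero) j * det (suc n) (minor zero j (M ∘ swap₀₁))))
      ≡⟨ *-sumFin (2 ℕ.+ n) (sign n) (term (suc n) (M ∘ swap₀₁)) ⟩
    sign n * det (2 ℕ.+ n) (M ∘ swap₀₁)
      ≡⟨ cong (sign n *_) (det-swap₀₁ n M) ⟩
    sign n * - det (2 ℕ.+ n) M
      ≡⟨ neg-distribʳ-* (sign n) _ ⟨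
    - (sign n * det (2 ℕ.+ n) M)
      ≡⟨ neg-distribˡ-* (sign n) _ ⟩
    - sign n * det (2 ℕ.+ n) M
      ≡⟨ cong (_* det (2 ℕ.+ n) M) (sign-suc n) ⟨
    sign (suc n) * det (2 ℕ.+ n) M ∎
    where
    open ≡-Reasoning
    open Rotated ρ
    solve : ∀ s m t d → s * m * (t * d) ≡ t * (s * m * d)
    solve = solve-∀
    minors : ∀ j → Rotated (minor zero j (M ∘ swap₀₁)) (minor zero j N)
    minors j .Rotated.init i c = init (suc i) (punchIn j c)
    minors j .Rotated.last c   = last (punchIn j c)

  -- The sign from the rows cancels the sign from the columns. The case i = j is separate because
  -- the map is then the identity and neither sign occurs.
  det-conjugate : ∀ n (M : Matrix n) i j →
    let τ = Components.transpose i j in det n (λ r c → M (τ r) (τ c)) ≡ det n M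
  det-conjugate n M i j with i Fin.≟ j
  ... | yes refl = det-cong n λ r c → cong₂ M (transpose-same r) (transpose-same c)
    where
    transpose-same : ∀ k → Components.transpose i i k ≡ k
    transpose-same k with k Fin.≟ i
    ... | yes k≡i = sym k≡i
    ... | no  _   with k Fin.≟ i
    ...   | yes k≡i = sym k≡i
    ...   | no  _   = refl
  ... | no i≢j = begin
    det n (λ r c → M (τ r) (τ c))         ≡⟨ swap (λ r c → M r (τ c)) ⟩
    - det n (λ r c → M r (τ c))           ≡⟨ cong -_ (det-transpose n (λ r c → M r (τ c))) ⟨
    - det n (transpose M ∘ τ)             ≡⟨ cong -_ (swap (transpose M)) ⟩
    - - det n (transpose M)               ≡⟨ neg-involutive (det n (transpose M)) ⟩
    det n (transpose M)                   ≡⟨ det-transpose n M ⟩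
    det n M                               ∎
    where
    open ≡-Reasoning
    τ = Components.transpose i j
    τ-i : τ i ≡ j
    τ-i rewrite dec-true (i Fin.≟ i) refl = refl
    τ-j : τ j ≡ i
    τ-j rewrite dec-false (j Fin.≟ i) (i≢j ∘ sym) | dec-true (j Fin.≟ j) refl = refl
    τ-rest : ∀ k → k ≢ i → k ≢ j → τ k ≡ k
    τ-rest k k≢i k≢j rewrite dec-false (k Fin.≟ i) k≢i | dec-false (k Fin.≟ j) k≢j = refl
    swap : ∀ N → det n (N ∘ τ) ≡ - det n N
    swap N = det-swap n i≢j record
      { rowᵢ = λ c → cong (λ r → N r c) τ-i
      ; rowⱼ = λ c → cong (λ r → N r c) τ-j
      ; rest = λ k k≢i k≢j c → cong (λ r → N r c) (τ-rest k k≢i k≢j) }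

  -- The sizes may differ syntactically, their equality being read off from `π`. This spares a
  -- separate count of the k-th power residues.
  det-permute : ∀ {m n} (π : Permutation m n) (M : Matrix n) →
    det m (λ i j → M (π ⟨$⟩ʳ i) (π ⟨$⟩ʳ j)) ≡ det n M
  det-permute π M with refl ← Permutation.↔⇒≡ π = trans
    (det-cong _ λ i j → cong₂ M (sym (eval-decompose π i)) (sym (eval-decompose π j)))
    (by-transpositions (decompose π) M)
    where
    by-transpositions : ∀ {n} (ts : TranspositionList n) (M : Matrix n) →
      det n (λ i j → M (eval ts ⟨$⟩ʳ i) (eval ts ⟨$⟩ʳ j)) ≡ det n M
    by-transpositions []             M = refl
    by-transpositions ((i , j) ∷ ts) M = trans
      (det-conjugate _ (λ r c → M (eval ts ⟨$⟩ʳ r) (eval ts ⟨$⟩ʳ c)) i j)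
      (by-transpositions ts M)

  det-column₀ : ∀ n (M : Matrix (suc n)) → (∀ i → M (suc i) zero ≡ 0ℤ) →
    det (suc n) M ≡ M zero zero * det n (minor zero zero M)
  det-column₀ n M Mᵢ₀≡0 = begin
    det (suc n) M
      ≡⟨ det-expand₀ n M ⟩
    sumFin (suc n) (term₀ n M)
      ≡⟨ sumFin-single (suc n) zero vanish ⟩
    1ℤ * M zero zero * det n (minor zero zero M)
      ≡⟨ cong (_* det n (minor zero zero M)) (*-identityˡ (M zero zero)) ⟩
    M zero zero * det n (minor zero zero M) ∎
    where
    open ≡-Reasoning
    vanish : ∀ i → i ≢ zero → term₀ n M i ≡ 0ℤ
    vanish zero    0≢0 = contradiction refl 0≢0
    vanish (suc i) _   = trans
      (cong (_* det n (minor (suc i) zero M))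
        (trans (cong (sign (suc (toℕ i)) *_) (Mᵢ₀≡0 i)) (*-zeroʳ (sign (suc (toℕ i))))))
      (*-zeroˡ (det n (minor (suc i) zero M)))

  det-block : ∀ n (M : Matrix (suc (suc n))) →
    (∀ i → M (suc (suc i)) zero ≡ 0ℤ) → (∀ i → M (suc (suc i)) (suc zero) ≡ 0ℤ) →
    det (suc (suc n)) M ≡
      (M zero zero * M (suc zero) (suc zero) - M zero (suc zero) * M (suc zero) zero) *
      det n (λ i j → M (suc (suc i)) (suc (suc j)))
  det-block n M col₀ col₁ = begin
    det (2 ℕ.+ n) M
      ≡⟨ det-expand₀ (suc n) M ⟩
    term₀ (suc n) M zero + (term₀ (suc n) M (suc zero) + sumFin n (λ i → term₀ (suc n) M (suc (suc i))))
      ≡⟨ cong₂ (λ s t → 1ℤ * a * s + (-1ℤ * c * t + sumFin n (λ i → term₀ (suc n) M (suc (suc i)))))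
           (det-column₀ n (minor zero zero M) col₁)
           (det-column₀ n (minor (suc zero) zero M) col₁) ⟩
    1ℤ * a * (d * D) + (-1ℤ * c * (b * D) + sumFin n (λ i → term₀ (suc n) M (suc (suc i))))
      ≡⟨ cong (λ s → 1ℤ * a * (d * D) + (-1ℤ * c * (b * D) + s)) (sumFin-zero n vanish) ⟩
    1ℤ * a * (d * D) + (-1ℤ * c * (b * D) + 0ℤ)
      ≡⟨ solve a b c d D ⟩
    (a * d - b * c) * D ∎
    where
    open ≡-Reasoning
    a = M zero zero
    b = M zero (suc zero)
    c = M (suc zero) zero
    d = M (suc zero) (suc zero)
    D = det n (λ i j → M (suc (suc i)) (suc (suc j)))
    vanish : ∀ i → term₀ (suc n) M (suc (suc i)) ≡ 0ℤ
    vanish i = trans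
      (cong (_* det (suc n) (minor (suc (suc i)) zero M))
        (trans (cong (sign (toℕ i) *_) (col₀ i)) (*-zeroʳ (sign (toℕ i)))))
      (*-zeroˡ (det (suc n) (minor (suc (suc i)) zero M)))
    solve : ∀ a b c d e → 1ℤ * a * (d * e) + (-1ℤ * c * (b * e) + 0ℤ) ≡ (a * d - b * c) * e
    solve = solve-∀

  det-add-rows : ∀ {n} (M : Matrix n) {r s t} a x y (v : Fin n → ℤ) → s ≢ r → t ≢ r →
    (∀ j → v j ≡ a * M r j + (x * M s j + y * M t j)) →
    det n (M [ r ]≔ v) ≡ a * det n M
  det-add-rows {n} M {r} {s} {t} a x y v s≢r t≢r v≡ = begin
    det n (M [ r ]≔ v)
      ≡⟨ det-≔-cong M r (λ j → trans (v≡ j) (cong (a * M r j +_) (sym (*-identityˡ (u j))))) ⟩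
    det n (M [ r ]≔ (λ j → a * M r j + 1ℤ * u j))
      ≡⟨ det-≔-linear M r a 1ℤ (M r) u ⟩
    a * det n (M [ r ]≔ M r) + 1ℤ * det n (M [ r ]≔ u)
      ≡⟨ cong (λ d → a * det n (M [ r ]≔ M r) + 1ℤ * d) (det-≔-linear M r x y (M s) (M t)) ⟩
    a * det n (M [ r ]≔ M r) + 1ℤ * (x * det n (M [ r ]≔ M s) + y * det n (M [ r ]≔ M t))
      ≡⟨ cong₂ (λ d e → a * det n (M [ r ]≔ M r) + 1ℤ * (x * d + y * e))
           (det-≔-row M s≢r) (det-≔-row M t≢r) ⟩
    a * det n (M [ r ]≔ M r) + 1ℤ * (x * 0ℤ + y * 0ℤ)
      ≡⟨ solve (a * det n (M [ r ]≔ M r)) x y ⟩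
    a * det n (M [ r ]≔ M r)
      ≡⟨ cong (a *_) (det-≔-self M r) ⟩
    a * det n M ∎
    where
    open ≡-Reasoning
    u = λ j → x * M s j + y * M t j
    solve : ∀ d x y → d + 1ℤ * (x * 0ℤ + y * 0ℤ) ≡ d
    solve = solve-∀

  -- The rows that still have their original values when the rows 2, 3, … are replaced
  -- in increasing order and row t + 2 is reached.
  data Untouched {n} (t : Fin n) : Fin (suc (suc n)) → Set where
    row₀  : Untouched t zero
    row₁  : Untouched t (suc zero)
    later : ∀ {s} → toℕ t < toℕ s → Untouched t (suc (suc s))

  -- Two source rows and a scaling factor cover both applications: elimination without fractions
  -- uses rows 0 and 1 with the pivot as `a`, while adding one row to another takes `a = 1ℤ` and
  -- gives the second source the coefficient 0.
  record RowReplacement {n} (a : ℤ) (M N : Matrix (suc (suc n))) (t : Fin n) : Set where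
    field
      {s₁ s₂}    : Fin (suc (suc n))
      untouched₁ : Untouched t s₁
      untouched₂ : Untouched t s₂
      x y        : ℤ
      combine    : ∀ j → N (suc (suc t)) j ≡ a * M (suc (suc t)) j + (x * M s₁ j + y * M s₂ j)

  untouched-≢ : ∀ {n} {t : Fin n} {s} → Untouched t s → s ≢ suc (suc t)
  untouched-≢ (later t<s) refl = ℕ.<-irrefl refl t<s

  -- `P k` has the rows of `N` at positions 2, ..., k + 1 and those of `M` elsewhere. Each passage
  -- from `P k` to `P (suc k)` adds only rows still equal to those of `M`, so it costs one factor
  -- `a`.
  det-replace-rows : ∀ n a (M N : Matrix (suc (suc n))) →
    (∀ j → N zero j ≡ M zero j) → (∀ j → N (suc zero) j ≡ M (suc zero) j) →
    (∀ t → RowReplacement a M N t) →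
    det (suc (suc n)) N ≡ a ^ n * det (suc (suc n)) M
  det-replace-rows n a M N N₀≡M₀ N₁≡M₁ replacement = trans (det-cong (2 ℕ.+ n) N≈) (step n ℕ.≤-refl)
    where
    P : ℕ → Matrix (suc (suc n))
    P k (suc (suc s)) = if does (toℕ s ℕ.<? k) then N (suc (suc s)) else M (suc (suc s))
    P k s             = M s

    P-new : ∀ {k s} → toℕ s < k → ∀ j → P k (suc (suc s)) j ≡ N (suc (suc s)) j
    P-new {k} {s} s<k j rewrite dec-true (toℕ s ℕ.<? k) s<k = refl

    P-old : ∀ {k s} → k ≤ toℕ s → ∀ j → P k (suc (suc s)) j ≡ M (suc (suc s)) j
    P-old {k} {s} k≤s j rewrite dec-false (toℕ s ℕ.<? k) (ℕ.≤⇒≯ k≤s) = refl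

    N≈ : N ≈ P n
    N≈ zero          = N₀≡M₀
    N≈ (suc zero)    = N₁≡M₁
    N≈ (suc (suc s)) j = sym (P-new (Fin.toℕ<n s) j)

    P-untouched : ∀ t {s} → Untouched t s → ∀ j → P (toℕ t) s j ≡ M s j
    P-untouched t row₀        j = refl
    P-untouched t row₁        j = refl
    P-untouched t (later t<s) j = P-old (ℕ.<⇒≤ t<s) j

    P-suc : ∀ t → P (suc (toℕ t)) ≈ P (toℕ t) [ suc (suc t) ]≔ N (suc (suc t))
    P-suc t = ≈-≔ (suc (suc t)) off (P-new ℕ.≤-refl)
      where
      off : ∀ i → i ≢ suc (suc t) → ∀ j → P (suc (toℕ t)) i j ≡ P (toℕ t) i j
      off zero          _   j = refl
      off (suc zero)    _   j = refl
      off (suc (suc s)) s≢t j with toℕ s ℕ.<? toℕ t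
      ... | yes s<t = trans (P-new (ℕ.m<n⇒m<1+n s<t) j) (sym (P-new s<t j))
      ... | no  s≮t = trans (P-old t<s j) (sym (P-old (ℕ.≮⇒≥ s≮t) j))
        where
        t<s : toℕ t < toℕ s
        t<s = ℕ.≤∧≢⇒< (ℕ.≮⇒≥ s≮t) λ t≡s → s≢t (cong (λ i → suc (suc i)) (sym (Fin.toℕ-injective t≡s)))

    step : ∀ k → k ≤ n → det (suc (suc n)) (P k) ≡ a ^ k * det (suc (suc n)) M
    step zero    _   = trans (det-cong (suc (suc n)) P₀≈) (sym (*-identityˡ (det (suc (suc n)) M)))
      where
      P₀≈ : P 0 ≈ M
      P₀≈ zero          j = refl
      P₀≈ (suc zero)    j = refl
      P₀≈ (suc (suc s)) j = refl
    step (suc k) k<n = begin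
      det (2 ℕ.+ n) (P (suc k))
        ≡⟨ cong (λ l → det (2 ℕ.+ n) (P (suc l))) t≡k ⟨
      det (2 ℕ.+ n) (P (suc (toℕ t)))
        ≡⟨ det-cong (2 ℕ.+ n) (P-suc t) ⟩
      det (2 ℕ.+ n) (P (toℕ t) [ suc (suc t) ]≔ N (suc (suc t)))
        ≡⟨ det-add-rows (P (toℕ t)) a x y (N (suc (suc t))) (untouched-≢ untouched₁) (untouched-≢ untouched₂)
             (λ j → trans (combine j) (sym (cong₂ (λ m r → a * m + r) (P-old ℕ.≤-refl j)
               (cong₂ (λ p q → x * p + y * q) (P-untouched t untouched₁ j) (P-untouched t untouched₂ j))))) ⟩
      a * det (2 ℕ.+ n) (P (toℕ t))
        ≡⟨ cong (λ l → a * det (2 ℕ.+ n) (P l)) t≡k ⟩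
      a * det (2 ℕ.+ n) (P k)
        ≡⟨ cong (a *_) (step k (ℕ.<⇒≤ k<n)) ⟩
      a * (a ^ k * det (2 ℕ.+ n) M)
        ≡⟨ *-assoc a (a ^ k) (det (2 ℕ.+ n) M) ⟨
      a ^ suc k * det (2 ℕ.+ n) M ∎
      where
      open ≡-Reasoning
      t = fromℕ< k<n
      t≡k = Fin.toℕ-fromℕ< k<n
      open RowReplacement (replacement t)

  -- Skew-symmetric matrices of even size have square determinant

  -- Write m = a g and n = b g with g the gcd. Then a² divides b², so a divides b because a and b
  -- are coprime, which forces a = 1 and m = g.
  m²∣n²⇒m∣n : ∀ m n .{{_ : ℕ.NonZero m}} → m ℕ.* m ℕ.∣ n ℕ.* n → m ℕ.∣ n
  m²∣n²⇒m∣n m@(suc _) n m²∣n² = go (gcd[m,n]∣m m n) (gcd[m,n]∣n m n)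
    where
    g = gcd m n
    instance
      g≢0 : ℕ.NonZero g
      g≢0 = ℕ.≢-nonZero (gcd[m,n]≢0 m n (inj₁ λ ()))
      gg≢0 : ℕ.NonZero (g ℕ.* g)
      gg≢0 = ℕ.m*n≢0 g g
    regroup : ∀ a g → a ℕ.* g ℕ.* (a ℕ.* g) ≡ a ℕ.* a ℕ.* (g ℕ.* g)
    regroup = solve-∀-ℕ
    go : g ℕ.∣ m → g ℕ.∣ n → m ℕ.∣ n
    go (ℕ.divides a m≡ag) (ℕ.divides b n≡bg) = subst (ℕ._∣ n) (trans (sym (ℕ.*-identityˡ g)) (trans (cong (ℕ._* g) (sym a≡1)) (sym m≡ag))) (gcd[m,n]∣n m n)
      where
      coprime : Coprime a b
      coprime {d} (d∣a , d∣b) = ℕ.∣1⇒≡1 (ℕ.*-cancelʳ-∣ g (subst (d ℕ.* g ℕ.∣_) (sym (ℕ.*-identityˡ g))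
        (gcd-greatest (subst (d ℕ.* g ℕ.∣_) (sym m≡ag) (ℕ.*-monoˡ-∣ g d∣a))
                      (subst (d ℕ.* g ℕ.∣_) (sym n≡bg) (ℕ.*-monoˡ-∣ g d∣b)))))
      a²∣b² : a ℕ.* a ℕ.∣ b ℕ.* b
      a²∣b² = ℕ.*-cancelʳ-∣ (g ℕ.* g) (subst₂ ℕ._∣_
        (trans (cong₂ ℕ._*_ m≡ag m≡ag) (regroup a g))
        (trans (cong₂ ℕ._*_ n≡bg n≡bg) (regroup b g)) m²∣n²)
      a≡1 : a ≡ 1
      a≡1 = coprime (ℕ.∣-refl , coprime-divisor coprime (ℕ.∣-trans (ℕ.m∣m*n a) a²∣b²))

  -- Removes the square of a pivot power that elimination without fractions leaves in front of the
  -- determinant.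
  square-quotient : ∀ b x D .{{_ : ℤ.NonZero b}} → b * b * D ≡ x * x → ∃ λ z → D ≡ z * z
  square-quotient b x D eq = root (ℤ.∣ᵤ⇒∣ {b} {x} (m²∣n²⇒m∣n ∣ b ∣ ∣ x ∣ (ℕ.divides ∣ D ∣ abs-eq)))
    where
    instance
      bb≢0 : ℤ.NonZero (b * b)
      bb≢0 = i*j≢0 b b
    abs-eq : ∣ x ∣ ℕ.* ∣ x ∣ ≡ ∣ D ∣ ℕ.* (∣ b ∣ ℕ.* ∣ b ∣)
    abs-eq = begin
      ∣ x ∣ ℕ.* ∣ x ∣               ≡⟨ abs-* x x ⟨
      ∣ x * x ∣                     ≡⟨ cong ∣_∣ eq ⟨
      ∣ b * b * D ∣                 ≡⟨ abs-* (b * b) D ⟩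
      ∣ b * b ∣ ℕ.* ∣ D ∣           ≡⟨ ℕ.*-comm ∣ b * b ∣ ∣ D ∣ ⟩
      ∣ D ∣ ℕ.* ∣ b * b ∣           ≡⟨ cong (∣ D ∣ ℕ.*_) (abs-* b b) ⟩
      ∣ D ∣ ℕ.* (∣ b ∣ ℕ.* ∣ b ∣)   ∎
      where open ≡-Reasoning
    regroup : ∀ z b → z * b * (z * b) ≡ b * b * (z * z)
    regroup = solve-∀
    root : b ℤ.∣ x → ∃ λ z → D ≡ z * z
    root (ℤ.divides z x≡zb) = z , *-cancelˡ-≡ (b * b) D (z * z)
      (trans eq (trans (cong₂ _*_ x≡zb x≡zb) (regroup z b)))

  Skew : ∀ {n} → Matrix n → Set
  Skew S = ∀ i j → S j i ≡ - S i j

  skew-diagonal : ∀ {n} {S : Matrix n} → Skew S → ∀ i → S i i ≡ 0ℤ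
  skew-diagonal {S = S} skew i = i≡-i⇒i≡0 (S i i) (skew i i)

  i≢0⇒i^n≢0 : ∀ i n .{{_ : ℤ.NonZero i}} → ℤ.NonZero (i ^ n)
  i≢0⇒i^n≢0 i zero    = _
  i≢0⇒i^n≢0 i (suc n) = i*j≢0 i (i ^ n)
    where
    instance
      _ : ℤ.NonZero (i ^ n)
      _ = i≢0⇒i^n≢0 i n

  -- Only the existence of a root is established; no Pfaffian is built. If the first row is not
  -- zero, a simultaneous transposition of rows and columns, which preserves the determinant and
  -- skewness, brings a nonzero entry to position (0,1).
  det-skew : ∀ q (S : Matrix (q ℕ.* 2)) → Skew S → ∃ λ z → det (q ℕ.* 2) S ≡ z * z
  det-skew-pivot : ∀ q (S : Matrix (suc q ℕ.* 2)) → Skew S → S zero (suc zero) ≢ 0ℤ →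
    ∃ λ z → det (suc q ℕ.* 2) S ≡ z * z

  det-skew zero    S skew = 1ℤ , refl
  det-skew (suc q) S skew with Fin.all? (λ j → S zero j ℤ.≟ 0ℤ)
  ... | yes S₀≡0 = 0ℤ , det-zero-row (suc q ℕ.* 2) zero S S₀≡0
  ... | no  S₀≢0 with Fin.¬∀⟶∃¬ (suc q ℕ.* 2) (λ j → S zero j ≡ 0ℤ) (λ j → S zero j ℤ.≟ 0ℤ) S₀≢0
  ...   | zero  , S₀₀≢0 = contradiction (skew-diagonal skew zero) S₀₀≢0
  ...   | suc j , S₀ⱼ≢0 =
    let z , eq = det-skew-pivot q (λ r c → S (τ r) (τ c)) (λ r c → skew (τ r) (τ c)) S₀ⱼ≢0
    in z , trans (sym (det-conjugate (suc q ℕ.* 2) S (suc zero) (suc j))) eq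
    where
    τ = Components.transpose (suc zero) (suc j)

  -- Eliminating the first two columns with the pivot a leaves a skew block.
  det-skew-pivot q S skew a≢0 =
    let w , eq = det-skew q S′ skew′
    in square-quotient (a ^ q) (a * w) (det (2 ℕ.+ n) S) (begin
      -- The `n = q ℕ.* 2` scaled rows contribute `a ^ n`, the square of `a ^ q`; the leading 2 × 2
      -- block contributes a².
      a ^ q * a ^ q * det (2 ℕ.+ n) S
        ≡⟨ cong (_* det (2 ℕ.+ n) S) (trans (cong (a ^ q *_) (sym (*-identityʳ (a ^ q)))) (^-*-assoc a q 2)) ⟩
      a ^ n * det (2 ℕ.+ n) S
        ≡⟨ det-replace-rows n a S N (λ _ → refl) (λ _ → refl) replacement ⟨
      det (2 ℕ.+ n) N
        ≡⟨ det-block n N column₀ column₁ ⟩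
      (S₀₀ * S₁₁ - a * S₁₀) * det n S′
        ≡⟨ cong₂ (λ p d → (p * S₁₁ - a * S₁₀) * d) (skew-diagonal skew zero) eq ⟩
      (0ℤ * S₁₁ - a * S₁₀) * (w * w)
        ≡⟨ cong (λ s → (0ℤ * S₁₁ - a * s) * (w * w)) (skew zero (suc zero)) ⟩
      (0ℤ * S₁₁ - a * - a) * (w * w)
        ≡⟨ regroup S₁₁ a w ⟩
      a * w * (a * w) ∎)
    where
    open ≡-Reasoning
    n = q ℕ.* 2
    a = S zero (suc zero)
    S₀₀ = S zero zero
    S₁₁ = S (suc zero) (suc zero)
    S₁₀ = S (suc zero) zero
    instance
      _ : ℤ.NonZero a
      _ = ℤ.≢-nonZero a≢0
      _ : ℤ.NonZero (a ^ q)
      _ = i≢0⇒i^n≢0 a q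
    N : Matrix (2 ℕ.+ n)
    -- The coefficients of rows 0 and 1 clear columns 0 and 1; what remains is `a` times the Schur
    -- complement of the leading 2 × 2 block.
    N (suc (suc i)) j = a * S (suc (suc i)) j +
      (- S (suc (suc i)) (suc zero) * S zero j + S (suc (suc i)) zero * S (suc zero) j)
    N i             j = S i j
    replacement : ∀ t → RowReplacement a S N t
    replacement t = record { untouched₁ = row₀ ; untouched₂ = row₁
      ; x = - S (suc (suc t)) (suc zero) ; y = S (suc (suc t)) zero ; combine = λ j → refl }
    regroup : ∀ s a w → (0ℤ * s - a * - a) * (w * w) ≡ a * w * (a * w)
    regroup = solve-∀
    column₀ : ∀ i → N (suc (suc i)) zero ≡ 0ℤ
    column₀ i = trans
      (cong₂ (λ s t → a * S (suc (suc i)) zero + (- S (suc (suc i)) (suc zero) * s + S (suc (suc i)) zero * t))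
        (skew-diagonal skew zero) (skew zero (suc zero)))
      (cancel a (S (suc (suc i)) zero) (S (suc (suc i)) (suc zero)))
      where
      cancel : ∀ a x y → a * x + (- y * 0ℤ + x * - a) ≡ 0ℤ
      cancel = solve-∀
    column₁ : ∀ i → N (suc (suc i)) (suc zero) ≡ 0ℤ
    column₁ i = trans
      (cong (λ s → a * S (suc (suc i)) (suc zero) + (- S (suc (suc i)) (suc zero) * a + S (suc (suc i)) zero * s))
        (skew-diagonal skew (suc zero)))
      (cancel a (S (suc (suc i)) zero) (S (suc (suc i)) (suc zero)))
      where
      cancel : ∀ a x y → a * y + (- y * a + x * 0ℤ) ≡ 0ℤ
      cancel = solve-∀
    S′ : Matrix n
    S′ i j = N (suc (suc i)) (suc (suc j))
    skew′ : Skew S′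
    skew′ i j rewrite skew (suc (suc i)) (suc (suc j))
                    | skew (suc (suc i)) zero | skew (suc (suc i)) (suc zero)
                    | skew (suc (suc j)) zero | skew (suc (suc j)) (suc zero) =
      antisymmetric a (S (suc (suc i)) (suc (suc j))) (S (suc (suc i)) zero) (S (suc (suc i)) (suc zero))
        (S (suc (suc j)) zero) (S (suc (suc j)) (suc zero))
      where
      antisymmetric : ∀ a s i₀ i₁ j₀ j₁ →
        a * - s + (- j₁ * - i₀ + j₀ * - i₁) ≡ - (a * s + (- i₁ * - j₀ + i₀ * - j₁))
      antisymmetric = solve-∀

  -- Twisted circulants

  window : ∀ n → (ℕ → ℕ → ℤ) → Matrix n
  window n M i j = M (toℕ i) (toℕ j)

  -- Both sides run over f 0, ..., f n; the equation moves the term that `sumFin` splits off from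
  -- the front to the back.
  sumFin-toℕ-suc : ∀ n (f : ℕ → ℤ) →
    sumFin n (f ∘ ℕ.suc ∘ toℕ) + f 0 ≡ sumFin n (f ∘ toℕ) + f n
  sumFin-toℕ-suc zero    f = refl
  sumFin-toℕ-suc (suc n) f = begin
    f 1 + sumFin n (f ∘ ℕ.suc ∘ ℕ.suc ∘ toℕ) + f 0
      ≡⟨ rearrange (f 1) (sumFin n (f ∘ ℕ.suc ∘ ℕ.suc ∘ toℕ)) (f 0) ⟩
    f 0 + (sumFin n (f ∘ ℕ.suc ∘ ℕ.suc ∘ toℕ) + f 1)
      ≡⟨ cong (f 0 +_) (sumFin-toℕ-suc n (f ∘ ℕ.suc)) ⟩
    f 0 + (sumFin n (f ∘ ℕ.suc ∘ toℕ) + f (suc n))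
      ≡⟨ +-assoc (f 0) (sumFin n (f ∘ ℕ.suc ∘ toℕ)) (f (suc n)) ⟨
    sumFin (suc n) (f ∘ toℕ) + f (suc n) ∎
    where
    open ≡-Reasoning
    rearrange : ∀ a s b → a + s + b ≡ b + (s + a)
    rearrange = solve-∀

  sumFin-rotate : ∀ n (f : ℕ → ℤ) → f n ≡ f 0 → sumFin n (f ∘ toℕ) ≡ sumFin n (f ∘ ℕ.suc ∘ toℕ)
  sumFin-rotate n f fₙ≡f₀ = ∙-cancelʳ (f 0) (sumFin n (f ∘ toℕ)) (sumFin n (f ∘ ℕ.suc ∘ toℕ))
    (sym (trans (sumFin-toℕ-suc n f) (cong (sumFin n (f ∘ toℕ) +_) fₙ≡f₀)))

  -- The real and imaginary parts of the n-th power of the imaginary unit.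
  re im : ℕ → ℤ
  re zero    = 1ℤ
  re (suc n) = - im n
  im zero    = 0ℤ
  im (suc n) = re n

  re-even : ∀ n → re (n ℕ.* 2) ≡ sign n
  re-even zero    = refl
  re-even (suc n) = trans (cong -_ (re-even n)) (sym (sign-suc n))

  im-even : ∀ n → im (n ℕ.* 2) ≡ 0ℤ
  im-even zero    = refl
  im-even (suc n) = cong -_ (im-even n)

  sign-even : ∀ n → sign (n ℕ.* 2) ≡ 1ℤ
  sign-even zero    = refl
  sign-even (suc n) = sign-even n

  sign-odd : ∀ n → sign (suc (n ℕ.* 2)) ≡ -1ℤ
  sign-odd zero    = refl
  sign-odd (suc n) = sign-odd n

  -- The indices are all natural numbers, so that shifts never leave the index set and `period`
  -- takes over the role of reduction modulo m. Finite matrices appear only as a `window`.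
  record TwistedCirculant (m : ℕ) (M : ℕ → ℕ → ℤ) : Set where
    field
      symmetric : ∀ i j → M i j ≡ M j i
      shift     : ∀ i j → M (suc i) (suc j) ≡ - M i j
      period    : ∀ i j → M i (j ℕ.+ m) ≡ M i j

    periodˡ : ∀ i j → M (i ℕ.+ m) j ≡ M i j
    periodˡ i j = trans (symmetric (i ℕ.+ m) j) (trans (period j i) (symmetric j i))

    shift-by : ∀ r i j → M (i ℕ.+ r) (j ℕ.+ r) ≡ sign r * M i j
    shift-by zero    i j rewrite ℕ.+-identityʳ i | ℕ.+-identityʳ j = sym (*-identityˡ (M i j))
    shift-by (suc r) i j rewrite ℕ.+-suc i r | ℕ.+-suc j r = begin
      M (suc (i ℕ.+ r)) (suc (j ℕ.+ r)) ≡⟨ shift (i ℕ.+ r) (j ℕ.+ r) ⟩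
      - M (i ℕ.+ r) (j ℕ.+ r)           ≡⟨ cong -_ (shift-by r i j) ⟩
      - (sign r * M i j)                ≡⟨ neg-distribˡ-* (sign r) (M i j) ⟩
      - sign r * M i j                  ≡⟨ cong (_* M i j) (sign-suc r) ⟨
      sign (suc r) * M i j              ∎
      where open ≡-Reasoning

  -- Moving the window down by one row is a rotation, since by periodicity the row lost at the top
  -- reappears at the bottom. The size is even, so every such rotation has sign -1.
  det-shift-rows : ∀ h {M} → TwistedCirculant (suc h ℕ.* 2) M → ∀ s →
    det (suc h ℕ.* 2) (window (suc h ℕ.* 2) (λ i → M (i ℕ.+ s))) ≡
    sign s * det (suc h ℕ.* 2) (window (suc h ℕ.* 2) M)
  det-shift-rows h {M} twisted zero    = trans
    (det-cong m λ i j → cong (λ r → M r (toℕ j)) (ℕ.+-identityʳ (toℕ i)))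
    (sym (*-identityˡ (det m (window m M))))
    where m = suc h ℕ.* 2
  det-shift-rows h {M} twisted (suc s) = begin
    det m (R (suc s))                    ≡⟨ det-rotate (suc (h ℕ.* 2)) rotated ⟩
    sign (suc (h ℕ.* 2)) * det m (R s)   ≡⟨ cong₂ _*_ (sign-odd h) (det-shift-rows h twisted s) ⟩
    -1ℤ * (sign s * det m (window m M))  ≡⟨ *-assoc -1ℤ (sign s) (det m (window m M)) ⟨
    -1ℤ * sign s * det m (window m M)    ≡⟨ cong (_* det m (window m M)) (trans (-1*i≡-i (sign s)) (sym (sign-suc s))) ⟩
    sign (suc s) * det m (window m M)    ∎
    where
    open ≡-Reasoning
    open TwistedCirculant twisted
    m = suc h ℕ.* 2
    R : ℕ → Matrix m
    R s = window m (λ i → M (i ℕ.+ s))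
    rotated : Rotated (R s) (R (suc s))
    rotated .Rotated.init i c = cong (λ r → M r (toℕ c))
      (trans (cong (ℕ._+ suc s) (Fin.toℕ-inject₁ i)) (ℕ.+-suc (toℕ i) s))
    rotated .Rotated.last c = trans
      (cong (λ r → M r (toℕ c)) (trans (cong (ℕ._+ suc s) (Fin.toℕ-fromℕ (suc (h ℕ.* 2)))) (reorder (h ℕ.* 2) s)))
      (periodˡ s (toℕ c))
      where
      reorder : ∀ x s → suc x ℕ.+ suc s ≡ s ℕ.+ suc (suc x)
      reorder = solve-∀-ℕ

  -- When h = m / 2 is odd, rotating the rows by h makes the matrix skew-symmetric.
  det-twisted-odd : ∀ h {M} → sign (suc h) ≡ -1ℤ → TwistedCirculant (suc h ℕ.* 2) M →
    ∃ λ z → - det (suc h ℕ.* 2) (window (suc h ℕ.* 2) M) ≡ z * z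
  det-twisted-odd h {M} odd twisted =
    let z , eq = det-skew r (window m (λ i → M (i ℕ.+ r))) (λ i j → skew (toℕ i) (toℕ j))
    in z , (begin
      - det m (window m M)                   ≡⟨ -1*i≡-i (det m (window m M)) ⟨
      -1ℤ * det m (window m M)               ≡⟨ cong (_* det m (window m M)) odd ⟨
      sign r * det m (window m M)            ≡⟨ det-shift-rows h twisted r ⟨
      det m (window m (λ i → M (i ℕ.+ r)))   ≡⟨ eq ⟩
      z * z                                  ∎)
    where
    open ≡-Reasoning
    open TwistedCirculant twisted
    r = suc h
    m = r ℕ.* 2
    double : ∀ j r → j ℕ.+ r ℕ.* 2 ≡ j ℕ.+ r ℕ.+ r
    double = solve-∀-ℕ
    skew : ∀ i j → M (j ℕ.+ r) i ≡ - M (i ℕ.+ r) j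
    -- Since j + m is j + r + r, periodicity makes room to shift both indices down by `r`, at the
    -- cost of `sign r`, which is -1; symmetry finishes.
    skew i j = sym (begin
      - M (i ℕ.+ r) j                  ≡⟨ cong -_ (period (i ℕ.+ r) j) ⟨
      - M (i ℕ.+ r) (j ℕ.+ m)          ≡⟨ cong (λ c → - M (i ℕ.+ r) c) (double j r) ⟩
      - M (i ℕ.+ r) (j ℕ.+ r ℕ.+ r)    ≡⟨ cong -_ (shift-by r i (j ℕ.+ r)) ⟩
      - (sign r * M i (j ℕ.+ r))       ≡⟨ cong (λ s → - (s * M i (j ℕ.+ r))) odd ⟩
      - (-1ℤ * M i (j ℕ.+ r))          ≡⟨ cong -_ (-1*i≡-i (M i (j ℕ.+ r))) ⟩
      - - M i (j ℕ.+ r)                ≡⟨ neg-involutive (M i (j ℕ.+ r)) ⟩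
      M i (j ℕ.+ r)                    ≡⟨ symmetric i (j ℕ.+ r) ⟩
      M (j ℕ.+ r) i                    ∎)

  -- Twisted circulants of size divisible by 4.

  module DoublyEven (u : ℕ) (even : sign u ≡ 1ℤ) {M} (twisted : TwistedCirculant (suc (suc u) ℕ.* 2) M) where
    open TwistedCirculant twisted
    open ≡-Reasoning
    -- `n` is the size of the skew block, and `s` is m - 1, so that moving the rows by `s` means, by
    -- periodicity, an index shift by -1.
    n m s : ℕ
    n = suc u ℕ.* 2
    m = suc (suc n)
    s = suc n

    -- The parts of Σ 𝕚 ^ j M i j, which is entry i of `M` applied to the vector of powers of 𝕚.
    Re Im : ℕ → ℤ
    Re i = sumFin m (λ j → re (toℕ j) * M i (toℕ j))
    Im i = sumFin m (λ j → im (toℕ j) * M i (toℕ j))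

    re-m : re m ≡ 1ℤ
    re-m = trans (re-even (suc (suc u))) even

    im-m : im m ≡ 0ℤ
    im-m = im-even (suc (suc u))

    -- Replacing j by j + 1 in the sum is allowed because 𝕚 ^ m = 1, and with `shift` it shows that
    -- the sum of row i + 1 is -𝕚 times that of row i. Hence everything is expressed by `Re 0` and
    -- `Re 1`.
    Re-suc : ∀ i → Re (suc i) ≡ Im i
    Re-suc i = trans
      (sumFin-rotate m (λ j → re j * M (suc i) j) (cong₂ _*_ re-m (period (suc i) 0)))
      (sumFin-cong m λ j → trans (cong (- im (toℕ j) *_) (shift i (toℕ j))) (solve (im (toℕ j)) (M i (toℕ j))))
      where
      solve : ∀ a b → - a * - b ≡ a * b
      solve = solve-∀

    Im-suc : ∀ i → Im (suc i) ≡ - Re i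
    Im-suc i = trans
      (sumFin-rotate m (λ j → im j * M (suc i) j) (cong₂ _*_ im-m (period (suc i) 0)))
      (trans (sumFin-cong m λ j → trans (cong (re (toℕ j) *_) (shift i (toℕ j))) (sym (neg-distribʳ-* (re (toℕ j)) (M i (toℕ j)))))
        (neg-sumFin m (λ j → re (toℕ j) * M i (toℕ j))))

    Re-m : Re m ≡ Re 0
    Re-m = sumFin-cong m λ j → cong (re (toℕ j) *_) (periodˡ 0 (toℕ j))

    Im-m : Im m ≡ Im 0
    Im-m = sumFin-cong m λ j → cong (im (toℕ j) *_) (periodˡ 0 (toℕ j))

    M′ : ℕ → ℕ → ℤ
    M′ i j = M (i ℕ.+ s) j

    -- T² + 1 acting on the rows except the first two: its rank is m - 2, so applying it to all rows
    -- would make the determinant vanish.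
    N : ℕ → ℕ → ℤ
    N (suc (suc i)) j = M′ (suc (suc i)) j + M′ (suc (suc (suc (suc i)))) j
    N i             j = M′ i j

    M′-wrap : ∀ i j → M′ (i ℕ.+ m) j ≡ M′ i j
    M′-wrap i j = trans (cong (λ r → M r j) (reorder i m s)) (periodˡ (i ℕ.+ s) j)
      where
      reorder : ∀ i m s → i ℕ.+ m ℕ.+ s ≡ i ℕ.+ s ℕ.+ m
      reorder = solve-∀-ℕ

    -- The row added to row t + 2 is row t + 4, which lies further down and is still unchanged. For
    -- the last two values of t it wraps around to row 0 or row 1, which are never replaced.
    replacement : ∀ t → RowReplacement 1ℤ (window m M′) (window m N) t
    replacement t = choose (toℕ t ℕ.+ 2 ℕ.<? n)
      where
      with-row : ∀ {s₁} → Untouched t s₁ → (∀ j → M′ (suc (suc (suc (suc (toℕ t))))) j ≡ M′ (toℕ s₁) j) →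
        RowReplacement 1ℤ (window m M′) (window m N) t
      with-row {s₁} untouched M′≡ = record
        { untouched₁ = untouched
        ; untouched₂ = row₀
        ; x = 1ℤ
        ; y = 0ℤ
        ; combine = λ j → trans
            (cong (M′ (suc (suc (toℕ t))) (toℕ j) +_) (M′≡ (toℕ j)))
            (solve (M′ (suc (suc (toℕ t))) (toℕ j)) (M′ (toℕ s₁) (toℕ j)) (M′ 0 (toℕ j)))
        }
        where
        solve : ∀ a b c → a + b ≡ 1ℤ * a + (1ℤ * b + 0ℤ * c)
        solve = solve-∀
      choose : _ → RowReplacement 1ℤ (window m M′) (window m N) t
      choose (yes t+2<n) = with-row
        (later (subst (toℕ t ℕ.<_) (sym (Fin.toℕ-fromℕ< t+2<n)) (ℕ.m<m+n (toℕ t) (ℕ.s≤s ℕ.z≤n))))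
        (λ j → cong (λ i → M′ (suc (suc i)) j) (trans (ℕ.+-comm 2 (toℕ t)) (sym (Fin.toℕ-fromℕ< t+2<n))))
      choose (no  t+2≮n) with toℕ t ℕ.+ 2 ℕ.≟ n
      ... | yes t+2≡n = with-row row₀ λ j → trans
        (cong (λ i → M′ (suc (suc i)) j) (trans (ℕ.+-comm 2 (toℕ t)) t+2≡n)) (M′-wrap 0 j)
      ... | no  t+2≢n = with-row row₁ λ j → trans
        (cong (λ i → M′ (suc (suc i)) j) (trans (ℕ.+-comm 2 (toℕ t)) t+2≡1+n)) (M′-wrap 1 j)
        where
        t+2≡1+n : toℕ t ℕ.+ 2 ≡ suc n
        t+2≡1+n = ℕ.≤-antisym
          (subst (ℕ._≤ suc n) (ℕ.+-comm 2 (toℕ t)) (ℕ.s≤s (Fin.toℕ<n t)))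
          (ℕ.≤∧≢⇒< (ℕ.≮⇒≥ t+2≮n) (t+2≢n ∘ sym))

    -- By `unfold` the entry is `M (suc i) j - M i (suc j)` at the shifted indices. Symmetry of `M`
    -- turns an exchange of the indices into an exchange of the two terms.
    N-skew : ∀ i j → N (suc (suc j)) (suc (suc i)) ≡ - N (suc (suc i)) (suc (suc j))
    N-skew i j = begin
      N (suc (suc j)) (suc (suc i))
        ≡⟨ unfold (suc (suc j)) (suc (suc i)) ⟩
      - M (suc (suc j)) (suc (suc (suc i))) + M (suc (suc (suc j))) (suc (suc i))
        ≡⟨ cong₂ (λ a b → - a + b) (symmetric (suc (suc j)) (suc (suc (suc i)))) (symmetric (suc (suc (suc j))) (suc (suc i))) ⟩
      - M (suc (suc (suc i))) (suc (suc j)) + M (suc (suc i)) (suc (suc (suc j)))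
        ≡⟨ solve (M (suc (suc (suc i))) (suc (suc j))) (M (suc (suc i)) (suc (suc (suc j)))) ⟩
      - (- M (suc (suc i)) (suc (suc (suc j))) + M (suc (suc (suc i))) (suc (suc j)))
        ≡⟨ cong -_ (unfold (suc (suc i)) (suc (suc j))) ⟨
      - N (suc (suc i)) (suc (suc j)) ∎
      where
      solve : ∀ a b → - a + b ≡ - (- b + a)
      solve = solve-∀
      unfold : ∀ i j → M′ i j + M′ (suc (suc i)) j ≡ - M i (suc j) + M (suc i) j
      unfold i j = cong₂ _+_
        (begin
          M (i ℕ.+ s) j                ≡⟨ neg-involutive (M (i ℕ.+ s) j) ⟨
          - - M (i ℕ.+ s) j            ≡⟨ cong -_ (shift (i ℕ.+ s) j) ⟨
          - M (suc (i ℕ.+ s)) (suc j)  ≡⟨ cong (λ r → - M r (suc j)) (sym (ℕ.+-suc i s)) ⟩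
          - M (i ℕ.+ m) (suc j)        ≡⟨ cong -_ (periodˡ i (suc j)) ⟩
          - M i (suc j)                ∎)
        (begin
          M (suc (suc (i ℕ.+ s))) j    ≡⟨ cong (λ r → M (suc r) j) (sym (ℕ.+-suc i s)) ⟩
          M (suc i ℕ.+ m) j            ≡⟨ periodˡ (suc i) j ⟩
          M (suc i) j                  ∎)

    combination : (ℕ → ℤ) → Fin m → ℤ
    combination c i = sumFin m (λ j → c (toℕ j) * N (toℕ i) (toℕ j))

    -- Stored transposed, so that the column operations on `N` become row operations.
    G : Matrix m
    G zero          i = combination re i
    G (suc zero)    i = combination im i
    G (suc (suc j)) i = N (toℕ i) (toℕ (suc (suc j)))

    -- Both replacements are unimodular, as `re 0` and `im 1` are 1. Since `im 0` is 0, the second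
    -- one does not notice that row 0 has already changed.
    det-G : det m G ≡ det m (window m N)
    det-G = begin
      det m G
        ≡⟨ det-cong m (≈-≔ (suc zero) off (λ i → sumFin-cong m (row₁-combination i))) ⟩
      det m (G₁ [ suc zero ]≔ (λ i → sumFin m (λ j → im (toℕ j) * G₁ j i)))
        ≡⟨ det-combine-rows G₁ (suc zero) (im ∘ toℕ) ⟩
      1ℤ * det m G₁
        ≡⟨ cong (1ℤ *_) (det-combine-rows (transpose (window m N)) zero (re ∘ toℕ)) ⟩
      1ℤ * (1ℤ * det m (transpose (window m N)))
        ≡⟨ trans (*-identityˡ (1ℤ * det m (transpose (window m N)))) (*-identityˡ (det m (transpose (window m N)))) ⟩
      det m (transpose (window m N))
        ≡⟨ det-transpose m (window m N) ⟩
      det m (window m N) ∎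
      where
      G₁ : Matrix m
      G₁ = transpose (window m N) [ zero ]≔ combination re
      off : ∀ i → i ≢ suc zero → ∀ j → G i j ≡ G₁ i j
      off zero          _   j = refl
      off (suc zero)    1≢1 j = contradiction refl 1≢1
      off (suc (suc i)) _   j = refl
      row₁-combination : ∀ i j → im (toℕ j) * N (toℕ i) (toℕ j) ≡ im (toℕ j) * G₁ j i
      row₁-combination i zero    = refl
      row₁-combination i (suc j) = refl

    private
      -- From index 2 on, a row of `N` is the sum of two rows of `M` at distance 2, and their values
      -- under `S` are opposite because (-𝕚)² = -1.
      vanish : ∀ (c : ℕ → ℤ) (S : ℕ → ℤ) → (∀ i → sumFin m (λ j → c (toℕ j) * M i (toℕ j)) ≡ S i) →
        (∀ i → S (suc (suc i)) ≡ - S i) → ∀ i → combination c (suc (suc i)) ≡ 0ℤ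
      vanish c S S≡ S-suc i = begin
        sumFin m (λ j → c (toℕ j) * (M′ k (toℕ j) + M′ (suc (suc k)) (toℕ j)))
          ≡⟨ sumFin-cong m (λ j → *-distribˡ-+ (c (toℕ j)) (M′ k (toℕ j)) (M′ (suc (suc k)) (toℕ j))) ⟩
        sumFin m (λ j → c (toℕ j) * M′ k (toℕ j) + c (toℕ j) * M′ (suc (suc k)) (toℕ j))
          ≡⟨ sumFin-+ m (λ j → c (toℕ j) * M′ k (toℕ j)) (λ j → c (toℕ j) * M′ (suc (suc k)) (toℕ j)) ⟩
        sumFin m (λ j → c (toℕ j) * M′ k (toℕ j)) + sumFin m (λ j → c (toℕ j) * M′ (suc (suc k)) (toℕ j))
          ≡⟨ cong₂ _+_ (S≡ (k ℕ.+ s)) (trans (S≡ (suc (suc (k ℕ.+ s)))) (S-suc (k ℕ.+ s))) ⟩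
        S (k ℕ.+ s) - S (k ℕ.+ s)
          ≡⟨ +-inverseʳ (S (k ℕ.+ s)) ⟩
        0ℤ ∎
        where
        k = suc (suc (toℕ i))

    -- The sign of the rotation by the odd number `s` cancels that of the 2 × 2 block, whose entries
    -- belong to the rows m - 1 and m of `M` and reduce to ±`Re 0` and ±`Re 1`.
    det-even : ∃ λ z → det m (window m M) ≡ (Re 0 * Re 0 + Re 1 * Re 1) * (z * z)
    det-even =
      let z , eq = det-skew (suc u) (λ i j → N (suc (suc (toℕ i))) (suc (suc (toℕ j)))) (λ i j → N-skew (toℕ i) (toℕ j))
      in z , (begin
        det m (window m M)
          ≡⟨ solve₁ (det m (window m M)) ⟩
        - (-1ℤ * det m (window m M))
          ≡⟨ cong (λ x → - (x * det m (window m M))) (sign-odd (suc u)) ⟨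
        - (sign s * det m (window m M))
          ≡⟨ cong -_ (det-shift-rows (suc u) twisted s) ⟨
        - det m (window m M′)
          ≡⟨ cong -_ (trans (cong (_* det m (window m M′)) (^-zeroˡ n)) (*-identityˡ (det m (window m M′)))) ⟨
        - (1ℤ ^ n * det m (window m M′))
          ≡⟨ cong -_ (det-replace-rows n 1ℤ (window m M′) (window m N) (λ _ → refl) (λ _ → refl) replacement) ⟨
        - det m (window m N)
          ≡⟨ cong -_ (trans (det-transpose m G) det-G) ⟨
        - det m (transpose G)
          ≡⟨ cong -_ (det-block n (transpose G)
               (vanish re Re (λ _ → refl) (λ i → trans (Re-suc (suc i)) (Im-suc i)))
               (vanish im Im (λ _ → refl) (λ i → trans (Im-suc (suc i)) (cong -_ (Re-suc i))))) ⟩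
        - ((Re s * Im m - Im s * Re m) * D)
          ≡⟨ cong₂ (λ p q → - ((p * Im m - q * Re m) * D)) Re-s (trans (sym (Re-suc s)) Re-m) ⟩
        - ((- Re 1 * Im m - Re 0 * Re m) * D)
          ≡⟨ cong₂ (λ p q → - ((- Re 1 * p - Re 0 * q) * D)) (trans Im-m (sym (Re-suc 0))) Re-m ⟩
        - ((- Re 1 * Re 1 - Re 0 * Re 0) * D)
          ≡⟨ solve₂ (Re 0) (Re 1) D ⟩
        (Re 0 * Re 0 + Re 1 * Re 1) * D
          ≡⟨ cong ((Re 0 * Re 0 + Re 1 * Re 1) *_) eq ⟩
        (Re 0 * Re 0 + Re 1 * Re 1) * (z * z) ∎)
      where
      D = det n (λ i j → N (suc (suc (toℕ i))) (suc (suc (toℕ j))))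
      solve₁ : ∀ d → d ≡ - (-1ℤ * d)
      solve₁ = solve-∀
      solve₂ : ∀ a b d → - ((- b * b - a * a) * d) ≡ (a * a + b * b) * d
      solve₂ = solve-∀
      Re-s : Re s ≡ - Re 1
      Re-s = begin
        Re s      ≡⟨ neg-involutive (Re s) ⟨
        - - Re s  ≡⟨ cong -_ (Im-suc s) ⟨
        - Im m    ≡⟨ cong -_ (trans Im-m (sym (Re-suc 0))) ⟩
        - Re 1    ∎

module LegendreMatrix where
  open Determinants
  import Data.Bool as Bool
  open Bool using (Bool; true; false; if_then_else_)
  open import Data.Nat.Base
  open import Data.Nat.Properties
  open import Data.Nat.DivMod
  open import Data.Nat.Divisibility using (_∣_; divides; m%n≡0⇒n∣m; n∣m⇒m%n≡0)
  open import Data.Nat.Primality using (Prime; euclidsLemma; prime⇒irreducible; ¬prime[1])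
  open import Data.Nat.Tactic.RingSolver using (solve-∀)
  import Data.Integer.Base as ℤ
  import Data.Integer.Properties as ℤ
  import Data.Integer.Divisibility.Signed as ℤ
  import Data.Integer.Tactic.RingSolver as ℤ
  open import Algebra.Properties.CommutativeMonoid.Sum ℤ.+-0-commutativeMonoid using (sum; sum-permute)
  open import Data.Fin.Base using (Fin; zero; suc; toℕ; fromℕ<; punchOut)
  import Data.Fin.Properties as Fin
  open import Data.Fin.Permutation using (Permutation; permutation; _⟨$⟩ʳ_)
  open import Data.List.Base using (List; lookup; upTo; applyUpTo)
  import Data.List.Relation.Unary.All as All
  open import Data.List.Relation.Unary.AllPairs using (_∷_)
  open import Data.List.Relation.Unary.Any as Any using (any?; satisfied)
  open import Data.List.Relation.Unary.Any.Properties using (lookup-index)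
  open import Data.List.Relation.Unary.Unique.Propositional using (Unique)
  import Data.List.Relation.Unary.Unique.Propositional.Properties as Unique
  open import Data.List.Membership.Propositional using (_∈_; lose)
  open import Data.List.Membership.Propositional.Properties
    using (∈-upTo⁺; ∈-lookup; ∈-filter⁺; ∈-filter⁻; ∈-applyUpTo⁺; ∈-applyUpTo⁻)
  open import Data.Product using (_×_; _,_; ∃; proj₁; proj₂)
  open import Data.Sum using (_⊎_; inj₁; inj₂)
  open import Function using (_∘_)
  open import Function.Definitions using (Injective)
  open import Relation.Nullary using (¬_; Dec; yes; no; does; contradiction)
  open import Relation.Nullary.Decidable using (dec-true; dec-false)
  open import Relation.Binary.Definitions using (tri<; tri≈; tri>)
  open import Relation.Binary.PropositionalEquality

  -- Counting and reindexing

  -- Runs downwards, in the order of the loops of `countPairs`, whereas `sumFin` starts at 0;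
  -- `pos-sumBelow` reconciles the two.
  sumBelow : ℕ → (ℕ → ℕ) → ℕ
  sumBelow zero    f = 0
  sumBelow (suc n) f = f n + sumBelow n f

  indicator : Bool → ℕ
  indicator b = if b then 1 else 0

  gridCount : (ℕ → ℕ → Bool) → ℕ → ℕ → ℕ
  gridCount P p zero    = 0
  gridCount P p (suc x) = sumBelow p (λ y → indicator (P x y)) + gridCount P p x

  gridCount-sum : ∀ P p x → gridCount P p x ≡ sumBelow x (λ x → sumBelow p (λ y → indicator (P x y)))
  gridCount-sum P p zero    = refl
  gridCount-sum P p (suc x) = cong (sumBelow p (λ y → indicator (P x y)) +_) (gridCount-sum P p x)

  -- The loops of countPairs are local to its definition, so their names are out of scope. The
  -- underscores stand for them and are solved by unification, for which the bound suc n has to be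
  -- abstracted: only then are the arguments of the loops distinct variables.
  countPairs-grid : ∀ n P → countPairs (suc n) P ≡ gridCount P (suc n) (suc n)
  rows-grid : ∀ P p x → _ ≡ gridCount P p x
  row-sum   : ∀ P p x y → _ ≡ sumBelow y (λ y → indicator (P x y))
  countPairs-grid n P with suc n
  ... | w = cong₂ _+_ (cong (indicator (P n n) +_) (row-sum P w n n)) (rows-grid P w n)
  rows-grid P p       zero    = refl
  rows-grid P zero    (suc x) = rows-grid P zero x
  rows-grid P (suc q) (suc x) with suc q | rows-grid P (suc q) x
  ... | w | ih = cong₂ _+_ (cong (indicator (P x q) +_) (row-sum P w x q)) ih
  row-sum P p x zero    = refl
  row-sum P p x (suc y) = cong (indicator (P x y) +_) (row-sum P p x y)

  sumBelow-cong : ∀ n {f g : ℕ → ℕ} → (∀ {i} → i < n → f i ≡ g i) → sumBelow n f ≡ sumBelow n g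
  sumBelow-cong zero    f≡g = refl
  sumBelow-cong (suc n) f≡g = cong₂ _+_ (f≡g ≤-refl) (sumBelow-cong n (f≡g ∘ m<n⇒m<1+n))

  sumBelow-zero : ∀ n {f : ℕ → ℕ} → (∀ {i} → i < n → f i ≡ 0) → sumBelow n f ≡ 0
  sumBelow-zero zero    f≡0 = refl
  sumBelow-zero (suc n) f≡0 = cong₂ _+_ (f≡0 ≤-refl) (sumBelow-zero n (f≡0 ∘ m<n⇒m<1+n))

  sumBelow-+ : ∀ n f g → sumBelow n (λ i → f i + g i) ≡ sumBelow n f + sumBelow n g
  sumBelow-+ zero    f g = refl
  sumBelow-+ (suc n) f g rewrite sumBelow-+ n f g = regroup (f n) (g n) (sumBelow n f) (sumBelow n g)
    where
    regroup : ∀ a b c d → a + b + (c + d) ≡ a + c + (b + d)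
    regroup = solve-∀

  sumBelow-point : ∀ n {a} → a < n → sumBelow n (λ i → indicator (does (i ≟ a))) ≡ 1
  sumBelow-point (suc n) {a} a<1+n with n ≟ a
  ... | yes refl = cong₂ _+_ (cong indicator (dec-true (n ≟ n) refl))
    (sumBelow-zero n λ {i} i<n → cong indicator (dec-false (i ≟ n) (<⇒≢ i<n)))
  ... | no  n≢a  = cong₂ _+_ (cong indicator (dec-false (n ≟ a) n≢a))
    (sumBelow-point n (≤∧≢⇒< (s≤s⁻¹ a<1+n) (n≢a ∘ sym)))

  unique⇒lookup-injective : ∀ {A : Set} {xs : List A} → Unique xs → Injective _≡_ _≡_ (lookup xs)
  unique⇒lookup-injective (x∉xs ∷ u) {zero}  {zero}  eq = refl
  unique⇒lookup-injective (x∉xs ∷ u) {zero}  {suc j} eq = contradiction eq (All.lookup x∉xs (∈-lookup j))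
  unique⇒lookup-injective (x∉xs ∷ u) {suc i} {zero}  eq = contradiction (sym eq) (All.lookup x∉xs (∈-lookup i))
  unique⇒lookup-injective (x∉xs ∷ u) {suc i} {suc j} eq = cong suc (unique⇒lookup-injective u eq)

  -- Sending an index to the index of the same value is inverted by the converse choice, thanks to
  -- injectivity. The increasing list of residues can thus be matched with the powers of h without
  -- comparing orders.
  same-image⇒permutation : ∀ {A : Set} {a b} (u : Fin a → A) (v : Fin b → A) →
    Injective _≡_ _≡_ u → Injective _≡_ _≡_ v →
    (∀ i → ∃ λ j → u i ≡ v j) → (∀ j → ∃ λ i → v j ≡ u i) →
    ∃ λ (π : Permutation a b) → ∀ i → u i ≡ v (π ⟨$⟩ʳ i)
  same-image⇒permutation u v u-inj v-inj u⊆v v⊆u =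
    permutation (proj₁ ∘ u⊆v) (proj₁ ∘ v⊆u)
      (λ j → v-inj (sym (trans (proj₂ (v⊆u j)) (proj₂ (u⊆v (proj₁ (v⊆u j)))))))
      (λ i → u-inj (sym (trans (proj₂ (u⊆v i)) (proj₂ (v⊆u (proj₁ (u⊆v i)))))))
    , proj₂ ∘ u⊆v

  -- A missed value could be punched out of the codomain, leaving an injection into a smaller finite
  -- set.
  injective⇒surjective : ∀ {n} (f : Fin n → Fin n) → Injective _≡_ _≡_ f → ∀ y → ∃ λ x → f x ≡ y
  injective⇒surjective {suc n} f f-inj y with Fin.any? (λ x → f x Fin.≟ y)
  ... | yes hit  = hit
  ... | no  miss = contradiction
    (Fin.injective⇒≤ {f = λ x → punchOut {i = y} (λ y≡fx → miss (x , sym y≡fx))}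
      (λ eq → f-inj (Fin.punchOut-injective {i = y} _ _ eq)))
    1+n≰n

  even⊎odd : ∀ a → (∃ λ b → a ≡ b * 2) ⊎ (∃ λ b → a ≡ suc (b * 2))
  even⊎odd a with a % 2 in eq | m≡m%n+[m/n]*n a 2 | m%n<n a 2
  ... | 0 | a≡ | _ = inj₁ (a / 2 , a≡)
  ... | 1 | a≡ | _ = inj₂ (a / 2 , a≡)
  ... | suc (suc _) | _ | s≤s (s≤s ())

  sign-+ : ∀ a b → sign (a + b) ≡ sign a ℤ.* sign b
  sign-+ zero    b = sym (ℤ.*-identityˡ (sign b))
  sign-+ (suc a) b = begin
    sign (suc (a + b))          ≡⟨ sign-suc (a + b) ⟩
    ℤ.- sign (a + b)            ≡⟨ cong ℤ.-_ (sign-+ a b) ⟩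
    ℤ.- (sign a ℤ.* sign b)     ≡⟨ ℤ.neg-distribˡ-* (sign a) (sign b) ⟩
    (ℤ.- sign a) ℤ.* sign b     ≡⟨ cong (λ i → i ℤ.* sign b) (sign-suc a) ⟨
    sign (suc a) ℤ.* sign b     ∎
    where open ≡-Reasoning

  -- Arithmetic modulo p

  module Residues (n : ℕ) (p-prime : Prime (suc n)) where
    p : ℕ
    p = suc n

    infix 4 _≋_
    -- Equality of remainders, because `mod (suc n) a` reduces to `a % suc n`: the tests inside
    -- `legendre` and `isKthPowerResidue` then speak of this relation directly.
    _≋_ : ℕ → ℕ → Set
    a ≋ b = a % p ≡ b % p

    ≋-+ : ∀ a b c d → a ≋ b → c ≋ d → a + c ≋ b + d
    ≋-+ a b c d a≋b c≋d = trans (%-distribˡ-+ a c p)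
      (trans (cong₂ (λ x y → (x + y) % p) a≋b c≋d) (sym (%-distribˡ-+ b d p)))

    ≋-* : ∀ a b c d → a ≋ b → c ≋ d → a * c ≋ b * d
    ≋-* a b c d a≋b c≋d = trans (%-distribˡ-* a c p)
      (trans (cong₂ (λ x y → (x * y) % p) a≋b c≋d) (sym (%-distribˡ-* b d p)))

    ≋-^ : ∀ a b e → a ≋ b → a ^ e ≋ b ^ e
    ≋-^ a b zero    a≋b = refl
    ≋-^ a b (suc e) a≋b = ≋-* a b (a ^ e) (b ^ e) a≋b (≋-^ a b e a≋b)

    ≋-% : ∀ a → a % p ≋ a
    ≋-% a = m%n%n≡m%n a p

    ≋⇒≡ : ∀ {a b} → a < p → b < p → a ≋ b → a ≡ b
    ≋⇒≡ a<p b<p a≋b = trans (sym (m<n⇒m%n≡m a<p)) (trans a≋b (m<n⇒m%n≡m b<p))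

    ∣⇒≋ : ∀ a b → ℤ.+ p ℤ.∣ (ℤ.+ a ℤ.- ℤ.+ b) → a ≋ b
    ∣⇒≋ a b (ℤ.divides (ℤ.+ q) eq) =
      trans (cong (_% p) (ℤ.+-injective (begin
        ℤ.+ a                               ≡⟨ solve (ℤ.+ a) (ℤ.+ b) ⟩
        ℤ.+ b ℤ.+ (ℤ.+ a ℤ.- ℤ.+ b)         ≡⟨ cong (λ d → ℤ.+ b ℤ.+ d) (trans eq (sym (ℤ.pos-* q p))) ⟩
        ℤ.+ b ℤ.+ ℤ.+ (q * p)               ≡⟨ ℤ.pos-+ b (q * p) ⟨
        ℤ.+ (b + q * p)                     ∎)))
      ([m+kn]%n≡m%n b q p)
      where
      open ≡-Reasoning
      solve : ∀ a b → a ≡ b ℤ.+ (a ℤ.- b)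
      solve = ℤ.solve-∀
    ∣⇒≋ a b (ℤ.divides ℤ.-[1+ q ] eq) = sym
      (trans (cong (_% p) (ℤ.+-injective (begin
        ℤ.+ b                               ≡⟨ solve (ℤ.+ a) (ℤ.+ b) ⟩
        ℤ.+ a ℤ.+ ℤ.- (ℤ.+ a ℤ.- ℤ.+ b)     ≡⟨ cong (λ d → ℤ.+ a ℤ.+ ℤ.- d) eq ⟩
        ℤ.+ a ℤ.+ ℤ.- (ℤ.-[1+ q ] ℤ.* ℤ.+ p) ≡⟨ cong (λ d → ℤ.+ a ℤ.+ d) (ℤ.neg-distribˡ-* ℤ.-[1+ q ] (ℤ.+ p)) ⟩
        ℤ.+ a ℤ.+ ℤ.+ suc q ℤ.* ℤ.+ p       ≡⟨ cong (λ d → ℤ.+ a ℤ.+ d) (ℤ.pos-* (suc q) p) ⟨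
        ℤ.+ a ℤ.+ ℤ.+ (suc q * p)           ≡⟨ ℤ.pos-+ a (suc q * p) ⟨
        ℤ.+ (a + suc q * p)                 ∎)))
      ([m+kn]%n≡m%n a (suc q) p))
      where
      open ≡-Reasoning
      solve : ∀ a b → b ≡ a ℤ.+ ℤ.- (a ℤ.- b)
      solve = ℤ.solve-∀

    ≋⇒∣ : ∀ a b → a ≋ b → ℤ.+ p ℤ.∣ (ℤ.+ a ℤ.- ℤ.+ b)
    ≋⇒∣ a b a≋b = ℤ.divides (ℤ.+ (a / p) ℤ.- ℤ.+ (b / p)) (begin
      ℤ.+ a ℤ.- ℤ.+ b
        ≡⟨ cong₂ (λ x y → x ℤ.- y) (split a) (trans (split b) (cong (λ r → ℤ.+ r ℤ.+ ℤ.+ (b / p) ℤ.* ℤ.+ p) (sym a≋b))) ⟩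
      (ℤ.+ (a % p) ℤ.+ ℤ.+ (a / p) ℤ.* ℤ.+ p) ℤ.- (ℤ.+ (a % p) ℤ.+ ℤ.+ (b / p) ℤ.* ℤ.+ p)
        ≡⟨ solve (ℤ.+ (a % p)) (ℤ.+ (a / p)) (ℤ.+ (b / p)) (ℤ.+ p) ⟩
      (ℤ.+ (a / p) ℤ.- ℤ.+ (b / p)) ℤ.* ℤ.+ p ∎)
      where
      open ≡-Reasoning
      solve : ∀ r x y q → (r ℤ.+ x ℤ.* q) ℤ.- (r ℤ.+ y ℤ.* q) ≡ (x ℤ.- y) ℤ.* q
      solve = ℤ.solve-∀
      split : ∀ a → ℤ.+ a ≡ ℤ.+ (a % p) ℤ.+ ℤ.+ (a / p) ℤ.* ℤ.+ p
      split a = begin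
        ℤ.+ a                                      ≡⟨ cong ℤ.+_ (m≡m%n+[m/n]*n a p) ⟩
        ℤ.+ (a % p + a / p * p)                    ≡⟨ ℤ.pos-+ (a % p) (a / p * p) ⟩
        ℤ.+ (a % p) ℤ.+ ℤ.+ (a / p * p)            ≡⟨ cong (λ d → ℤ.+ (a % p) ℤ.+ d) (ℤ.pos-* (a / p) p) ⟩
        ℤ.+ (a % p) ℤ.+ ℤ.+ (a / p) ℤ.* ℤ.+ p      ∎

    euclid : ∀ i j → ℤ.+ p ℤ.∣ i ℤ.* j → (ℤ.+ p ℤ.∣ i) ⊎ (ℤ.+ p ℤ.∣ j)
    euclid i j p∣ij with euclidsLemma ℤ.∣ i ∣ ℤ.∣ j ∣ p-prime (subst (p ∣_) (ℤ.abs-* i j) (ℤ.∣⇒∣ᵤ p∣ij))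
    ... | inj₁ p∣i = inj₁ (ℤ.∣ᵤ⇒∣ p∣i)
    ... | inj₂ p∣j = inj₂ (ℤ.∣ᵤ⇒∣ p∣j)

    ∣⇒≋0 : ∀ a → ℤ.+ p ℤ.∣ ℤ.+ a → a ≋ 0
    ∣⇒≋0 a p∣a = n∣m⇒m%n≡0 a p (ℤ.∣⇒∣ᵤ p∣a)

    *-≋0 : ∀ a b → a * b ≋ 0 → (a ≋ 0) ⊎ (b ≋ 0)
    *-≋0 a b ab≋0 with euclidsLemma a b p-prime (m%n≡0⇒n∣m (a * b) p ab≋0)
    ... | inj₁ p∣a = inj₁ (n∣m⇒m%n≡0 a p p∣a)
    ... | inj₂ p∣b = inj₂ (n∣m⇒m%n≡0 b p p∣b)

    *-cancel-≋ : ∀ a b c → ¬ a ≋ 0 → a * b ≋ a * c → b ≋ c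
    *-cancel-≋ a b c a≉0 ab≋ac with euclid (ℤ.+ a) (ℤ.+ b ℤ.- ℤ.+ c)
        (subst (ℤ.+ p ℤ.∣_) factor (≋⇒∣ (a * b) (a * c) ab≋ac))
      where
      solve : ∀ a b c → a ℤ.* b ℤ.- a ℤ.* c ≡ a ℤ.* (b ℤ.- c)
      solve = ℤ.solve-∀
      factor : ℤ.+ (a * b) ℤ.- ℤ.+ (a * c) ≡ ℤ.+ a ℤ.* (ℤ.+ b ℤ.- ℤ.+ c)
      factor = trans (cong₂ (λ x y → x ℤ.- y) (ℤ.pos-* a b) (ℤ.pos-* a c)) (solve (ℤ.+ a) (ℤ.+ b) (ℤ.+ c))
    ... | inj₁ p∣a   = contradiction (∣⇒≋0 a p∣a) a≉0
    ... | inj₂ p∣b-c = ∣⇒≋ b c p∣b-c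

    -- Here `x′` stands for -x. Over ℤ the difference of squares factors as (y - x)(y + x), and p
    -- divides one of the factors.
    squares-≋ : ∀ x x′ y → x + x′ ≡ p → y * y ≋ x * x → (y ≋ x) ⊎ (y ≋ x′)
    squares-≋ x x′ y x+x′≡p y²≋x² with euclid (ℤ.+ y ℤ.- ℤ.+ x) (ℤ.+ y ℤ.+ ℤ.+ x)
        (subst (ℤ.+ p ℤ.∣_) factor (≋⇒∣ (y * y) (x * x) y²≋x²))
      where
      solve : ∀ x y → y ℤ.* y ℤ.- x ℤ.* x ≡ (y ℤ.- x) ℤ.* (y ℤ.+ x)
      solve = ℤ.solve-∀
      factor : ℤ.+ (y * y) ℤ.- ℤ.+ (x * x) ≡ (ℤ.+ y ℤ.- ℤ.+ x) ℤ.* (ℤ.+ y ℤ.+ ℤ.+ x)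
      factor = trans (cong₂ (λ a b → a ℤ.- b) (ℤ.pos-* y y) (ℤ.pos-* x x)) (solve (ℤ.+ x) (ℤ.+ y))
    ... | inj₁ p∣y-x = inj₁ (∣⇒≋ y x p∣y-x)
    ... | inj₂ p∣y+x = inj₂ (∣⇒≋ y x′ (subst (ℤ.+ p ℤ.∣_) shifted (ℤ.∣m∣n⇒∣m-n p∣y+x (ℤ.divides ℤ.1ℤ (sym (ℤ.*-identityˡ (ℤ.+ p)))))))
      where
      open ≡-Reasoning
      solve : ∀ x x′ y → (y ℤ.+ x) ℤ.- (x ℤ.+ x′) ≡ y ℤ.- x′
      solve = ℤ.solve-∀
      shifted : (ℤ.+ y ℤ.+ ℤ.+ x) ℤ.- ℤ.+ p ≡ ℤ.+ y ℤ.- ℤ.+ x′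
      shifted = begin
        (ℤ.+ y ℤ.+ ℤ.+ x) ℤ.- ℤ.+ p                    ≡⟨ cong (λ q → (ℤ.+ y ℤ.+ ℤ.+ x) ℤ.- ℤ.+ q) x+x′≡p ⟨
        (ℤ.+ y ℤ.+ ℤ.+ x) ℤ.- ℤ.+ (x + x′)             ≡⟨ cong (λ q → (ℤ.+ y ℤ.+ ℤ.+ x) ℤ.- q) (ℤ.pos-+ x x′) ⟩
        (ℤ.+ y ℤ.+ ℤ.+ x) ℤ.- (ℤ.+ x ℤ.+ ℤ.+ x′)       ≡⟨ solve (ℤ.+ x) (ℤ.+ x′) (ℤ.+ y) ⟩
        ℤ.+ y ℤ.- ℤ.+ x′                               ∎

    opposite-square : ∀ x x′ → x + x′ ≡ p → x′ * x′ ≋ x * x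
    opposite-square x x′ x+x′≡p = ∣⇒≋ (x′ * x′) (x * x) (ℤ.divides (ℤ.+ x′ ℤ.- ℤ.+ x) (begin
      ℤ.+ (x′ * x′) ℤ.- ℤ.+ (x * x)                ≡⟨ cong₂ (λ a b → a ℤ.- b) (ℤ.pos-* x′ x′) (ℤ.pos-* x x) ⟩
      ℤ.+ x′ ℤ.* ℤ.+ x′ ℤ.- ℤ.+ x ℤ.* ℤ.+ x        ≡⟨ solve (ℤ.+ x) (ℤ.+ x′) ⟩
      (ℤ.+ x′ ℤ.- ℤ.+ x) ℤ.* (ℤ.+ x ℤ.+ ℤ.+ x′)    ≡⟨ cong (λ q → (ℤ.+ x′ ℤ.- ℤ.+ x) ℤ.* q) (trans (sym (ℤ.pos-+ x x′)) (cong ℤ.+_ x+x′≡p)) ⟩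
      (ℤ.+ x′ ℤ.- ℤ.+ x) ℤ.* ℤ.+ p                 ∎))
      where
      open ≡-Reasoning
      solve : ∀ x x′ → x′ ℤ.* x′ ℤ.- x ℤ.* x ≡ (x′ ℤ.- x) ℤ.* (x ℤ.+ x′)
      solve = ℤ.solve-∀

    -- The Legendre symbol and the number of square roots.

    legendre-cong : ∀ a b → a ≋ b → legendre p a ≡ legendre p b
    legendre-cong a b a≋b = cong symbol a≋b
      where
      symbol : ℕ → ℤ.ℤ
      symbol r = if does (r ≟ 0) then ℤ.+ 0
        else if does (any? (λ x → x * x % p ≟ r) (upTo p)) then ℤ.+ 1 else ℤ.- (ℤ.+ 1)

    legendre-zero : ∀ a → a ≋ 0 → legendre p a ≡ ℤ.0ℤ
    legendre-zero a a≋0 rewrite dec-true (a % p ≟ 0) a≋0 = refl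

    legendre-square : ∀ a x → ¬ a ≋ 0 → x * x ≋ a → legendre p a ≡ ℤ.1ℤ
    legendre-square a x a≉0 x²≋a
      rewrite dec-false (a % p ≟ 0) a≉0
            | dec-true (any? (λ x → x * x % p ≟ a % p) (upTo p))
                (lose (∈-upTo⁺ (m%n<n x p)) (trans (≋-* (x % p) x (x % p) x (≋-% x) (≋-% x)) x²≋a)) = refl

    legendre-nonsquare : ∀ a → ¬ a ≋ 0 → (∀ x → ¬ x * x ≋ a) → legendre p a ≡ ℤ.-1ℤ
    legendre-nonsquare a a≉0 nonsquare
      rewrite dec-false (a % p ≟ 0) a≉0
            | dec-false (any? (λ x → x * x % p ≟ a % p) (upTo p)) (λ any → nonsquare (proj₁ (satisfied any)) (proj₂ (satisfied any))) = refl

    roots : ℕ → ℕ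
    roots a = sumBelow p (λ y → indicator (does (y * y % p ≟ a % p)))

    module _ (a : ℕ) where
      is-root : ∀ {y} → y * y ≋ a → does (y * y % p ≟ a % p) ≡ true
      is-root {y} = dec-true (y * y % p ≟ a % p)

      not-root : ∀ {y} → ¬ y * y ≋ a → does (y * y % p ≟ a % p) ≡ false
      not-root {y} = dec-false (y * y % p ≟ a % p)

      roots-zero : a ≋ 0 → roots a ≡ 1
      roots-zero a≋0 = trans (sumBelow-cong p (cong indicator ∘ only-zero)) (sumBelow-point p (s≤s z≤n))
        where
        only-zero : ∀ {y} → y < p → does (y * y % p ≟ a % p) ≡ does (y ≟ 0)
        only-zero {zero}  _   = is-root {0} (sym a≋0)
        only-zero {suc y} y<p = not-root {suc y} λ y²≋a → nonzero (*-≋0 (suc y) (suc y) (trans y²≋a a≋0))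
          where
          nonzero : ¬ (suc y ≋ 0 ⊎ suc y ≋ 0)
          nonzero (inj₁ y≋0) = 1+n≢0 (≋⇒≡ y<p (s≤s z≤n) y≋0)
          nonzero (inj₂ y≋0) = 1+n≢0 (≋⇒≡ y<p (s≤s z≤n) y≋0)

      roots-nonsquare : (∀ x → ¬ x * x ≋ a) → roots a ≡ 0
      roots-nonsquare nonsquare = sumBelow-zero p λ {y} _ → cong indicator (not-root {y} (nonsquare y))

      -- The roots below p are z = x % p and p - z, which differ because p is odd.
      roots-square : (∀ z → z + z ≢ p) → ∀ x → ¬ a ≋ 0 → x * x ≋ a → roots a ≡ 2
      roots-square odd x a≉0 x²≋a = begin
        roots a
          ≡⟨ sumBelow-cong p two-roots ⟩
        sumBelow p (λ y → indicator (does (y ≟ z)) + indicator (does (y ≟ z′)))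
          ≡⟨ sumBelow-+ p (λ y → indicator (does (y ≟ z))) (λ y → indicator (does (y ≟ z′))) ⟩
        sumBelow p (λ y → indicator (does (y ≟ z))) + sumBelow p (λ y → indicator (does (y ≟ z′)))
          ≡⟨ cong₂ _+_ (sumBelow-point p z<p) (sumBelow-point p z′<p) ⟩
        2 ∎
        where
        open ≡-Reasoning
        z = x % p
        z′ = p ∸ z
        z<p : z < p
        z<p = m%n<n x p
        z+z′≡p : z + z′ ≡ p
        z+z′≡p = m+[n∸m]≡n (<⇒≤ z<p)
        z²≋a : z * z ≋ a
        z²≋a = trans (≋-* z x z x (≋-% x) (≋-% x)) x²≋a
        z′²≋a : z′ * z′ ≋ a
        z′²≋a = trans (opposite-square z z′ z+z′≡p) z²≋a
        z≢0 : z ≢ 0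
        z≢0 z≡0 = a≉0 (trans (sym x²≋a) (≋-* x 0 x 0 z≡0 z≡0))
        z′<p : z′ < p
        z′<p = ∸-monoʳ-< (n≢0⇒n>0 z≢0) (<⇒≤ z<p)
        z≢z′ : z ≢ z′
        z≢z′ z≡z′ = odd z (trans (cong (z +_) z≡z′) z+z′≡p)
        two-roots : ∀ {y} → y < p → indicator (does (y * y % p ≟ a % p)) ≡
                                    indicator (does (y ≟ z)) + indicator (does (y ≟ z′))
        two-roots {y} y<p = choose (y ≟ z) (y ≟ z′)
          where
          cases : ∀ b c → does (y ≟ z) ≡ b → does (y ≟ z′) ≡ c → indicator (does (y * y % p ≟ a % p)) ≡ indicator b + indicator c →
            indicator (does (y * y % p ≟ a % p)) ≡ indicator (does (y ≟ z)) + indicator (does (y ≟ z′))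
          cases b c y≟z y≟z′ eq = trans eq (sym (cong₂ (λ b c → indicator b + indicator c) y≟z y≟z′))
          choose : _ → _ → indicator (does (y * y % p ≟ a % p)) ≡ indicator (does (y ≟ z)) + indicator (does (y ≟ z′))
          choose (yes y≡z) _          = cases true false (dec-true (y ≟ z) y≡z)
            (dec-false (y ≟ z′) (λ y≡z′ → z≢z′ (trans (sym y≡z) y≡z′)))
            (cong indicator (is-root {y} (trans (cong (λ t → t * t % p) y≡z) z²≋a)))
          choose (no y≢z) (yes y≡z′) = cases false true (dec-false (y ≟ z) y≢z) (dec-true (y ≟ z′) y≡z′)
            (cong indicator (is-root {y} (trans (cong (λ t → t * t % p) y≡z′) z′²≋a)))
          choose (no y≢z) (no y≢z′)  = cases false false (dec-false (y ≟ z) y≢z) (dec-false (y ≟ z′) y≢z′)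
            (cong indicator (not-root {y} λ y²≋a → neither (squares-≋ z z′ y z+z′≡p (trans y²≋a (sym z²≋a)))))
            where
            neither : ¬ (y ≋ z ⊎ y ≋ z′)
            neither (inj₁ y≋z)  = y≢z (≋⇒≡ y<p z<p y≋z)
            neither (inj₂ y≋z′) = y≢z′ (≋⇒≡ y<p z′<p y≋z′)

      roots-legendre : (∀ z → z + z ≢ p) → ℤ.+ roots a ≡ ℤ.1ℤ ℤ.+ legendre p a
      roots-legendre odd = choose (a % p ≟ 0) (any? (λ x → x * x % p ≟ a % p) (upTo p))
        where
        choose : _ → _ → ℤ.+ roots a ≡ ℤ.1ℤ ℤ.+ legendre p a
        choose (yes a≋0) _         = trans (cong ℤ.+_ (roots-zero a≋0)) (cong (ℤ._+_ ℤ.1ℤ) (sym (legendre-zero a a≋0)))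
        choose (no  a≉0) (yes any) = let x , x²≋a = satisfied any in
          trans (cong ℤ.+_ (roots-square odd x a≉0 x²≋a)) (cong (ℤ._+_ ℤ.1ℤ) (sym (legendre-square a x a≉0 x²≋a)))
        choose (no  a≉0) (no ¬any) =
          trans (cong ℤ.+_ (roots-nonsquare nonsquare)) (cong (ℤ._+_ ℤ.1ℤ) (sym (legendre-nonsquare a a≉0 nonsquare)))
          where
          nonsquare : ∀ x → ¬ x * x ≋ a
          nonsquare x x²≋a = ¬any (lose (∈-upTo⁺ (m%n<n x p)) (trans (≋-* (x % p) x (x % p) x (≋-% x) (≋-% x)) x²≋a))

  -- Powers of a primitive root.

  module PrimitiveRoot (n : ℕ) (p-prime : Prime (suc n)) (g : ℕ) (primitiveRoot : IsPrimitiveRoot (suc n) g)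
            (half : ℕ) (even : n ≡ half * 2) where
    open Residues n p-prime

    instance
      n≢0 : NonZero n
      n≢0 = ≢-nonZero λ n≡0 → ¬prime[1] (subst (λ n → Prime (suc n)) n≡0 p-prime)

    1≉0 : ¬ 1 ≋ 0
    1≉0 1≋0 = 1+n≢0 (≋⇒≡ (s≤s (>-nonZero⁻¹ n)) (s≤s z≤n) 1≋0)

    order : g ^ n ≋ 1
    order = proj₁ primitiveRoot

    g≉0 : ¬ g ≋ 0
    g≉0 g≋0 = 1≉0 (trans (sym order) (vanish n))
      where
      vanish : ∀ n .{{_ : NonZero n}} → g ^ n ≋ 0
      vanish (suc n) = ≋-* g 0 (g ^ n) (g ^ n) g≋0 refl

    power-nonzero : ∀ e → ¬ g ^ e ≋ 0
    power-nonzero zero    = 1≉0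
    power-nonzero (suc e) g^e≋0 with *-≋0 g (g ^ e) g^e≋0
    ... | inj₁ g≋0   = g≉0 g≋0
    ... | inj₂ g^e≋0′ = power-nonzero e g^e≋0′

    power-period : ∀ e q → g ^ (e + q * n) ≋ g ^ e
    power-period e zero    = cong (λ e → g ^ e % p) (+-identityʳ e)
    power-period e (suc q) = begin
      g ^ (e + (n + q * n)) % p   ≡⟨ cong (λ e → g ^ e % p) (regroup e n (q * n)) ⟩
      g ^ (n + (e + q * n)) % p   ≡⟨ cong (_% p) (^-distribˡ-+-* g n (e + q * n)) ⟩
      g ^ n * g ^ (e + q * n) % p ≡⟨ ≋-* (g ^ n) 1 (g ^ (e + q * n)) (g ^ e) order (power-period e q) ⟩
      1 * g ^ e % p               ≡⟨ cong (_% p) (*-identityˡ (g ^ e)) ⟩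
      g ^ e % p                   ∎
      where
      open ≡-Reasoning
      regroup : ∀ a b c → a + (b + c) ≡ b + (a + c)
      regroup = solve-∀

    power-% : ∀ e → g ^ (e % n) ≋ g ^ e
    power-% e = trans (sym (power-period (e % n) (e / n))) (cong (λ e → g ^ e % p) (sym (m≡m%n+[m/n]*n e n)))

    private
      power-distinct : ∀ {i j} → i < j → j < n → ¬ g ^ i ≋ g ^ j
      power-distinct {i} {j} i<j j<n g^i≋g^j = proj₂ primitiveRoot (j ∸ i) (m<n⇒0<n∸m i<j) (≤-<-trans (m∸n≤m j i) j<n)
        (*-cancel-≋ (g ^ i) (g ^ (j ∸ i)) 1 (power-nonzero i) (begin
          g ^ i * g ^ (j ∸ i) % p  ≡⟨ cong (_% p) (^-distribˡ-+-* g i (j ∸ i)) ⟨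
          g ^ (i + (j ∸ i)) % p    ≡⟨ cong (λ e → g ^ e % p) (m+[n∸m]≡n (<⇒≤ i<j)) ⟩
          g ^ j % p                ≡⟨ g^i≋g^j ⟨
          g ^ i % p                ≡⟨ cong (_% p) (*-identityʳ (g ^ i)) ⟨
          g ^ i * 1 % p            ∎))
        where open ≡-Reasoning

    power-injective : ∀ {i j} → i < n → j < n → g ^ i ≋ g ^ j → i ≡ j
    power-injective {i} {j} i<n j<n g^i≋g^j with <-cmp i j
    ... | tri< i<j _ _ = contradiction g^i≋g^j (power-distinct i<j j<n)
    ... | tri≈ _ i≡j _ = i≡j
    ... | tri> _ _ j<i = contradiction (sym g^i≋g^j) (power-distinct j<i i<n)

    power-injective-% : ∀ i j → g ^ i ≋ g ^ j → i % n ≡ j % n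
    power-injective-% i j g^i≋g^j = power-injective (m%n<n i n) (m%n<n j n)
      (trans (power-% i) (trans g^i≋g^j (sym (power-% j))))

    residue-index : ∀ a → ¬ a ≋ 0 → ∃ λ (i : Fin n) → suc (toℕ i) ≡ a % p
    residue-index a a≉0 with a % p | m%n<n a p
    ... | zero  | _   = contradiction refl a≉0
    ... | suc r | r<n = fromℕ< (s≤s⁻¹ r<n) , cong suc (Fin.toℕ-fromℕ< (s≤s⁻¹ r<n))

    -- Exponents and nonzero residues are both numbered by `Fin n`, so the injectivity of the powers
    -- already makes them exhaustive.
    discrete-log : ∀ a → ¬ a ≋ 0 → ∃ λ (i : Fin n) → a ≋ g ^ toℕ i
    discrete-log a a≉0 =
      let y , y≡a = residue-index a a≉0
          i , eq  = injective⇒surjective index index-injective y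
      in i , trans (sym y≡a) (trans (cong (suc ∘ toℕ) (sym eq)) (proj₂ (residue-index (g ^ toℕ i) (power-nonzero (toℕ i)))))
      where
      index : Fin n → Fin n
      index i = proj₁ (residue-index (g ^ toℕ i) (power-nonzero (toℕ i)))
      index-injective : ∀ {i j} → index i ≡ index j → i ≡ j
      index-injective {i} {j} eq = Fin.toℕ-injective (power-injective (Fin.toℕ<n i) (Fin.toℕ<n j)
        (trans (sym (proj₂ (residue-index (g ^ toℕ i) (power-nonzero (toℕ i)))))
        (trans (cong (suc ∘ toℕ) eq) (proj₂ (residue-index (g ^ toℕ j) (power-nonzero (toℕ j)))))))

    -- For odd t, a root x = g ^ i would give 2i ≡ t modulo n, which is impossible since n is even.
    legendre-power : ∀ t → legendre p (g ^ t) ≡ sign t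
    legendre-power t with even⊎odd t
    ... | inj₁ (b , refl) = trans (legendre-square (g ^ t) (g ^ b) (power-nonzero t) (cong (_% p) square)) (sym (sign-even b))
      where
      square : g ^ b * g ^ b ≡ g ^ (b * 2)
      square = trans (cong (g ^ b *_) (sym (*-identityʳ (g ^ b)))) (^-*-assoc g b 2)
    ... | inj₂ (b , refl) = trans (legendre-nonsquare (g ^ t) (power-nonzero t) nonsquare) (sym (sign-odd b))
      where
      2∣n : 2 ∣ n
      2∣n = divides half even
      nonsquare : ∀ x → ¬ x * x ≋ g ^ t
      nonsquare x x²≋g^t = 0≢1 (begin
        0                ≡⟨ m*n%n≡0 i 2 ⟨
        i * 2 % 2        ≡⟨ m∣n⇒o%n%m≡o%m 2 n (i * 2) 2∣n ⟨
        i * 2 % n % 2    ≡⟨ cong (_% 2) (power-injective-% (i * 2) t even-power) ⟩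
        t % n % 2        ≡⟨ m∣n⇒o%n%m≡o%m 2 n t 2∣n ⟩
        t % 2            ≡⟨ [m+kn]%n≡m%n 1 b 2 ⟩
        1                ∎)
        where
        open ≡-Reasoning
        0≢1 : 0 ≢ 1
        0≢1 ()
        x≉0 : ¬ x ≋ 0
        x≉0 x≋0 = power-nonzero t (trans (sym x²≋g^t) (≋-* x 0 x 0 x≋0 x≋0))
        i = toℕ (proj₁ (discrete-log x x≉0))
        x≋g^i : x ≋ g ^ i
        x≋g^i = proj₂ (discrete-log x x≉0)
        even-power : g ^ (i * 2) ≋ g ^ t
        even-power = begin
          g ^ (i * 2) % p          ≡⟨ cong (_% p) (^-*-assoc g i 2) ⟨
          g ^ i * (g ^ i * 1) % p  ≡⟨ cong (λ y → g ^ i * y % p) (*-identityʳ (g ^ i)) ⟩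
          g ^ i * g ^ i % p        ≡⟨ ≋-* x (g ^ i) x (g ^ i) x≋g^i x≋g^i ⟨
          x * x % p                ≡⟨ x²≋g^t ⟩
          g ^ t % p                ∎

    legendre-power-* : ∀ s a → legendre p (g ^ s * a) ≡ sign s ℤ.* legendre p a
    legendre-power-* s a with a % p ≟ 0
    ... | yes a≋0 = begin
      legendre p (g ^ s * a)      ≡⟨ legendre-zero (g ^ s * a) (trans (≋-* (g ^ s) (g ^ s) a 0 refl a≋0) (cong (_% p) (*-zeroʳ (g ^ s)))) ⟩
      ℤ.0ℤ                        ≡⟨ ℤ.*-zeroʳ (sign s) ⟨
      sign s ℤ.* ℤ.0ℤ             ≡⟨ cong (ℤ._*_ (sign s)) (legendre-zero a a≋0) ⟨
      sign s ℤ.* legendre p a     ∎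
      where open ≡-Reasoning
    ... | no a≉0 = begin
      legendre p (g ^ s * a)      ≡⟨ legendre-cong (g ^ s * a) (g ^ s * g ^ t) (≋-* (g ^ s) (g ^ s) a (g ^ t) refl a≋g^t) ⟩
      legendre p (g ^ s * g ^ t)  ≡⟨ cong (legendre p) (^-distribˡ-+-* g s t) ⟨
      legendre p (g ^ (s + t))    ≡⟨ legendre-power (s + t) ⟩
      sign (s + t)                ≡⟨ sign-+ s t ⟩
      sign s ℤ.* sign t           ≡⟨ cong (ℤ._*_ (sign s)) (legendre-power t) ⟨
      sign s ℤ.* legendre p (g ^ t) ≡⟨ cong (ℤ._*_ (sign s)) (legendre-cong a (g ^ t) a≋g^t) ⟨
      sign s ℤ.* legendre p a     ∎
      where
      open ≡-Reasoning
      t = toℕ (proj₁ (discrete-log a a≉0))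
      a≋g^t : a ≋ g ^ t
      a≋g^t = proj₂ (discrete-log a a≉0)

  -- The matrix of Legendre symbols

  does⇒ : ∀ {A : Set} (a? : Dec A) → does a? ≡ true → A
  does⇒ (yes a) _ = a

  sumFin≡sum : ∀ n f → sumFin n f ≡ sum f
  sumFin≡sum zero    f = refl
  sumFin≡sum (suc n) f = cong (λ s → f zero ℤ.+ s) (sumFin≡sum n (f ∘ suc))

  sumFin-permute : ∀ {m n} (π : Permutation m n) f → sumFin m (λ i → f (π ⟨$⟩ʳ i)) ≡ sumFin n f
  sumFin-permute {m} {n} π f = trans (sumFin≡sum m (λ i → f (π ⟨$⟩ʳ i))) (trans (sym (sum-permute f π)) (sym (sumFin≡sum n f)))

  sumFin-snoc : ∀ n (f : ℕ → ℤ.ℤ) → sumFin (suc n) (f ∘ toℕ) ≡ f n ℤ.+ sumFin n (f ∘ toℕ)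
  sumFin-snoc n f = begin
    f 0 ℤ.+ sumFin n (λ i → f (suc (toℕ i)))   ≡⟨ ℤ.+-comm (f 0) (sumFin n (λ i → f (suc (toℕ i)))) ⟩
    sumFin n (λ i → f (suc (toℕ i))) ℤ.+ f 0   ≡⟨ sumFin-toℕ-suc n f ⟩
    sumFin n (f ∘ toℕ) ℤ.+ f n                 ≡⟨ ℤ.+-comm (sumFin n (f ∘ toℕ)) (f n) ⟩
    f n ℤ.+ sumFin n (f ∘ toℕ)                 ∎
    where open ≡-Reasoning

  pos-sumBelow : ∀ n f → ℤ.+ sumBelow n f ≡ sumFin n (λ i → ℤ.+ f (toℕ i))
  pos-sumBelow zero    f = refl
  pos-sumBelow (suc n) f = trans (ℤ.pos-+ (f n) (sumBelow n f))
    (trans (cong (λ s → ℤ.+ f n ℤ.+ s) (pos-sumBelow n f)) (sym (sumFin-snoc n (λ i → ℤ.+ f i))))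

  sumFin-one : ∀ n → sumFin n (λ _ → ℤ.1ℤ) ≡ ℤ.+ n
  sumFin-one zero    = refl
  sumFin-one (suc n) = cong (λ s → ℤ.1ℤ ℤ.+ s) (sumFin-one n)

  sumFin-++ : ∀ a b (f : ℕ → ℤ.ℤ) →
    sumFin (a + b) (f ∘ toℕ) ≡ sumFin a (f ∘ toℕ) ℤ.+ sumFin b (λ i → f (a + toℕ i))
  sumFin-++ zero    b f = sym (ℤ.+-identityˡ (sumFin b (f ∘ toℕ)))
  sumFin-++ (suc a) b f = trans (cong (λ s → f 0 ℤ.+ s) (sumFin-++ a b (f ∘ suc)))
    (sym (ℤ.+-assoc (f 0) (sumFin a (λ i → f (suc (toℕ i)))) (sumFin b (λ i → f (suc (a + toℕ i))))))

  sumFin-periodic : ∀ c r (f : ℕ → ℤ.ℤ) → (∀ i → f (r + i) ≡ f i) →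
    sumFin (c * r) (f ∘ toℕ) ≡ ℤ.+ c ℤ.* sumFin r (f ∘ toℕ)
  sumFin-periodic zero    r f periodic = sym (ℤ.*-zeroˡ (sumFin r (f ∘ toℕ)))
  sumFin-periodic (suc c) r f periodic = begin
    sumFin (r + c * r) (f ∘ toℕ)
      ≡⟨ sumFin-++ r (c * r) f ⟩
    sumFin r (f ∘ toℕ) ℤ.+ sumFin (c * r) (λ i → f (r + toℕ i))
      ≡⟨ cong (λ s → sumFin r (f ∘ toℕ) ℤ.+ s) (trans (sumFin-cong (c * r) (periodic ∘ toℕ)) (sumFin-periodic c r f periodic)) ⟩
    sumFin r (f ∘ toℕ) ℤ.+ ℤ.+ c ℤ.* sumFin r (f ∘ toℕ)
      ≡⟨ ℤ.suc-* (ℤ.+ c) (sumFin r (f ∘ toℕ)) ⟨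
    ℤ.+ suc c ℤ.* sumFin r (f ∘ toℕ) ∎
    where open ≡-Reasoning

  sumFin-pairs : ∀ r (f : ℕ → ℤ.ℤ) →
    sumFin (r * 2) (f ∘ toℕ) ≡ sumFin r (λ i → f (toℕ i * 2) ℤ.+ f (suc (toℕ i * 2)))
  sumFin-pairs zero    f = refl
  sumFin-pairs (suc r) f = trans
    (sym (ℤ.+-assoc (f 0) (f 1) (sumFin (r * 2) (λ i → f (suc (suc (toℕ i)))))))
    (cong (λ s → f 0 ℤ.+ f 1 ℤ.+ s) (sumFin-pairs r (λ i → f (suc (suc i)))))

  module KthPowers (n : ℕ) (p-prime : Prime (suc n)) (g : ℕ) (primitiveRoot : IsPrimitiveRoot (suc n) g)
                   (l r : ℕ) (n≡ : n ≡ suc (l * 2) * (r * 2)) where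
    k m : ℕ
    k = suc (l * 2)
    m = r * 2

    open Residues n p-prime
    open PrimitiveRoot n p-prime g primitiveRoot (k * r) (trans n≡ (sym (*-assoc k r 2)))

    M : ℕ → ℕ → ℤ.ℤ
    M i j = legendre p (g ^ (k * i) + g ^ (k * j))

    power-k-period : ∀ j → g ^ (k * (j + m)) ≋ g ^ (k * j)
    power-k-period j = trans (cong (λ e → g ^ e % p) exponent) (power-period (k * j) 1)
      where
      exponent : k * (j + m) ≡ k * j + 1 * n
      exponent = trans (*-distribˡ-+ k j m) (cong (k * j +_) (trans (sym n≡) (sym (*-identityˡ n))))

    twisted : TwistedCirculant m M
    twisted = record
      { symmetric = λ i j → cong (legendre p) (+-comm (g ^ (k * i)) (g ^ (k * j)))
      -- The factor g ^ k comes out of both summands, and its symbol is -1 because k is odd.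
      ; shift = λ i j → begin
          legendre p (g ^ (k * suc i) + g ^ (k * suc j))
            ≡⟨ cong (legendre p) (trans (cong₂ _+_ (power-suc i) (power-suc j))
                 (sym (*-distribˡ-+ (g ^ k) (g ^ (k * i)) (g ^ (k * j))))) ⟩
          legendre p (g ^ k * (g ^ (k * i) + g ^ (k * j)))
            ≡⟨ legendre-power-* k (g ^ (k * i) + g ^ (k * j)) ⟩
          sign k ℤ.* M i j
            ≡⟨ cong (λ s → s ℤ.* M i j) (sign-odd l) ⟩
          ℤ.-1ℤ ℤ.* M i j
            ≡⟨ ℤ.-1*i≡-i (M i j) ⟩
          ℤ.- M i j ∎
      ; period = λ i j → legendre-cong (g ^ (k * i) + g ^ (k * (j + m))) (g ^ (k * i) + g ^ (k * j))
          (≋-+ (g ^ (k * i)) (g ^ (k * i)) (g ^ (k * (j + m))) (g ^ (k * j)) refl (power-k-period j))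
      }
      where
      open ≡-Reasoning
      power-suc : ∀ i → g ^ (k * suc i) ≡ g ^ k * g ^ (k * i)
      power-suc i = trans (cong (g ^_) (*-suc k i)) (^-distribˡ-+-* g k (k * i))

    instance
      m≢0 : NonZero m
      m≢0 = ≢-nonZero λ m≡0 → ≢-nonZero⁻¹ n (trans n≡ (trans (cong (k *_) m≡0) (*-zeroʳ k)))

    kth-powers : Fin m → ℕ
    kth-powers j = g ^ (k * toℕ j) % p

    kth-powers-injective : ∀ {i j} → kth-powers i ≡ kth-powers j → i ≡ j
    kth-powers-injective {i} {j} eq = Fin.toℕ-injective (*-cancelˡ-≡ (toℕ i) (toℕ j) k
      (power-injective (bound i) (bound j) eq))
      where
      bound : ∀ i → k * toℕ i < n
      bound i = subst (k * toℕ i <_) (sym n≡) (*-monoʳ-< k (Fin.toℕ<n i))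

    private
      P? : ∀ a → Dec (isKthPowerResidue p k a ≡ true)
      P? a = isKthPowerResidue p k a Bool.≟ true

    -- If a ≡ x ^ k and x ≡ g ^ s, then a ≡ g ^ (sk). Since km = n, replacing s by s % m changes the
    -- exponent by a multiple of n.
    residue⇒power : ∀ {a} → a ∈ kthResidues p k → ∃ λ j → a ≡ kth-powers j
    residue⇒power {a} a∈ =
      let a∈range , residue = ∈-filter⁻ P? {xs = applyUpTo suc n} a∈
          i , i<n , a≡1+i   = ∈-applyUpTo⁻ suc a∈range
          x , x^k≋a         = satisfied (does⇒ (any? (λ x → x ^ k % p ≟ a % p) (upTo p)) residue)
      in from-root i i<n a≡1+i x x^k≋a
      where
      from-root : ∀ i → i < n → a ≡ suc i → ∀ x → x ^ k ≋ a → ∃ λ j → a ≡ kth-powers j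
      from-root i i<n refl x x^k≋a = fromℕ< (m%n<n s m) , (begin
        suc i                                     ≡⟨ m<n⇒m%n≡m (s≤s i<n) ⟨
        suc i % p                                 ≡⟨ x^k≋a ⟨
        x ^ k % p                                 ≡⟨ ≋-^ x (g ^ s) k x≋g^s ⟩
        (g ^ s) ^ k % p                           ≡⟨ cong (_% p) (^-*-assoc g s k) ⟩
        g ^ (s * k) % p                           ≡⟨ cong (λ e → g ^ e % p) exponent ⟩
        g ^ (k * (s % m) + s / m * n) % p         ≡⟨ power-period (k * (s % m)) (s / m) ⟩
        g ^ (k * (s % m)) % p                     ≡⟨ cong (λ e → g ^ (k * e) % p) (Fin.toℕ-fromℕ< (m%n<n s m)) ⟨
        g ^ (k * toℕ (fromℕ< (m%n<n s m))) % p    ∎)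
        where
        open ≡-Reasoning
        x≉0 : ¬ x ≋ 0
        x≉0 x≋0 = 1+n≢0 (≋⇒≡ (s≤s i<n) (s≤s z≤n) (trans (sym x^k≋a) (≋-^ x 0 k x≋0)))
        s = toℕ (proj₁ (discrete-log x x≉0))
        x≋g^s : x ≋ g ^ s
        x≋g^s = proj₂ (discrete-log x x≉0)
        regroup : ∀ a b c d → (a + b * c) * d ≡ d * a + b * (d * c)
        regroup = solve-∀
        exponent : s * k ≡ k * (s % m) + s / m * n
        exponent = trans (cong (_* k) (m≡m%n+[m/n]*n s m))
          (trans (regroup (s % m) (s / m) m k) (cong (λ e → k * (s % m) + s / m * e) (sym n≡)))

    power⇒residue : ∀ j → kth-powers j ∈ kthResidues p k
    -- The search covers only the numbers below p, so the root supplied is the remainder of g ^ j.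
    power⇒residue j = ∈-filter⁺ P? in-range (dec-true (any? (λ x → x ^ k % p ≟ a % p) (upTo p))
      (lose (∈-upTo⁺ (m%n<n (g ^ toℕ j) p)) root))
      where
      a = kth-powers j
      in-range : a ∈ applyUpTo suc n
      in-range = let i , eq = residue-index (g ^ (k * toℕ j)) (power-nonzero (k * toℕ j))
        in subst (_∈ applyUpTo suc n) eq (∈-applyUpTo⁺ suc (Fin.toℕ<n i))
      root : (g ^ toℕ j % p) ^ k ≋ a
      root = begin
        (g ^ toℕ j % p) ^ k % p      ≡⟨ ≋-^ (g ^ toℕ j % p) (g ^ toℕ j) k (≋-% (g ^ toℕ j)) ⟩
        (g ^ toℕ j) ^ k % p          ≡⟨ cong (_% p) (trans (^-*-assoc g (toℕ j) k) (cong (g ^_) (*-comm (toℕ j) k))) ⟩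
        g ^ (k * toℕ j) % p          ≡⟨ ≋-% (g ^ (k * toℕ j)) ⟨
        g ^ (k * toℕ j) % p % p      ∎
        where open ≡-Reasoning

    residues-unique : Unique (kthResidues p k)
    residues-unique = Unique.filter⁺ P? (Unique.applyUpTo⁺₁ suc n λ i<j _ → <⇒≢ i<j ∘ suc-injective)

    det-W : det (dimW p k) (W p k) ≡ det m (window m M)
    det-W =
      let π , π-correct = same-image⇒permutation (lookup (kthResidues p k)) kth-powers
            (unique⇒lookup-injective residues-unique) kth-powers-injective
            (λ i → residue⇒power (∈-lookup i))
            (λ j → Any.index (power⇒residue j) , lookup-index (power⇒residue j))
      in trans
        (det-cong (dimW p k) λ i j → trans
          (cong₂ (λ a b → legendre p (a + b)) (π-correct i) (π-correct j))
          (legendre-cong (kth-powers (π ⟨$⟩ʳ i) + kth-powers (π ⟨$⟩ʳ j))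
                         (g ^ (k * toℕ (π ⟨$⟩ʳ i)) + g ^ (k * toℕ (π ⟨$⟩ʳ j)))
            (≋-+ (kth-powers (π ⟨$⟩ʳ i)) (g ^ (k * toℕ (π ⟨$⟩ʳ i))) (kth-powers (π ⟨$⟩ʳ j)) (g ^ (k * toℕ (π ⟨$⟩ʳ j)))
              (≋-% (g ^ (k * toℕ (π ⟨$⟩ʳ i)))) (≋-% (g ^ (k * toℕ (π ⟨$⟩ʳ j)))))))
        (det-permute π (window m M))

    -- Point counts as character sums.

    sum-nonzero : ∀ (f : ℕ → ℤ.ℤ) → (∀ a → f (a % p) ≡ f a) →
      sumFin n (λ i → f (suc (toℕ i))) ≡ sumFin n (λ i → f (g ^ toℕ i))
    sum-nonzero f f-% =
      -- Both 1, ..., n and the reduced powers of g list every nonzero residue once.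
      let π , π-correct = same-image⇒permutation {a = n} {b = n} (λ i → suc (toℕ i)) (λ j → g ^ toℕ j % p)
            (Fin.toℕ-injective ∘ suc-injective)
            (λ {i} {j} eq → Fin.toℕ-injective (power-injective (Fin.toℕ<n i) (Fin.toℕ<n j) eq))
            (λ i → let j , eq = discrete-log (suc (toℕ i)) (λ 1+i≋0 → 1+n≢0 (≋⇒≡ (s≤s (Fin.toℕ<n i)) (s≤s z≤n) 1+i≋0))
                   in j , trans (sym (m<n⇒m%n≡m (s≤s (Fin.toℕ<n i)))) eq)
            (λ j → let i , eq = residue-index (g ^ toℕ j) (power-nonzero (toℕ j)) in i , sym eq)
      in trans
        (sumFin-cong n λ i → trans (cong f (π-correct i)) (f-% (g ^ toℕ (π ⟨$⟩ʳ i))))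
        (sumFin-permute π (λ j → f (g ^ toℕ j)))

    odd-p : ∀ z → z + z ≢ p
    odd-p z z+z≡p = 0≢1 (begin
      0                      ≡⟨ m*n%n≡0 z 2 ⟨
      z * 2 % 2              ≡⟨ cong (_% 2) (trans (double z) z+z≡p) ⟩
      suc n % 2              ≡⟨ cong (λ n → suc n % 2) (trans n≡ (sym (*-assoc k r 2))) ⟩
      (1 + k * r * 2) % 2    ≡⟨ [m+kn]%n≡m%n 1 (k * r) 2 ⟩
      1                      ∎)
      where
      open ≡-Reasoning
      0≢1 : 0 ≢ 1
      0≢1 ()
      double : ∀ z → z * 2 ≡ z + z
      double = solve-∀

    curve : ℕ → ℕ → ℕ
    curve b x = x * (x ^ (2 * k) + b)

    affine-excess : ∀ b → ℤ.+ p ℤ.- ℤ.+ affinePoints p k b ≡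
      ℤ.- sumFin n (λ i → legendre p (curve b (suc (toℕ i))))
    affine-excess b = begin
      ℤ.+ p ℤ.- ℤ.+ affinePoints p k b
        ≡⟨ cong (λ a → ℤ.+ p ℤ.- ℤ.+ a) (trans (countPairs-grid n on-curve) (gridCount-sum on-curve p p)) ⟩
      ℤ.+ p ℤ.- ℤ.+ sumBelow p (λ x → roots (curve b x))
        ≡⟨ cong (λ s → ℤ.+ p ℤ.- s) (pos-sumBelow p (λ x → roots (curve b x))) ⟩
      ℤ.+ p ℤ.- sumFin p (λ i → ℤ.+ roots (curve b (toℕ i)))
        ≡⟨ cong (λ s → ℤ.+ p ℤ.- s) (sumFin-cong p λ i → roots-legendre (curve b (toℕ i)) odd-p) ⟩
      ℤ.+ p ℤ.- sumFin p (λ i → ℤ.1ℤ ℤ.+ legendre p (curve b (toℕ i)))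
        ≡⟨ cong (λ s → ℤ.+ p ℤ.- s) (trans (sumFin-+ p (λ _ → ℤ.1ℤ) (λ i → legendre p (curve b (toℕ i))))
             (cong (λ s → s ℤ.+ sumFin p (λ i → legendre p (curve b (toℕ i)))) (sumFin-one p))) ⟩
      -- The split-off `ℤ.0ℤ` is the symbol at x = 0, where `curve b 0` computes to 0.
      ℤ.+ p ℤ.- (ℤ.+ p ℤ.+ (ℤ.0ℤ ℤ.+ sumFin n (λ i → legendre p (curve b (suc (toℕ i))))))
        ≡⟨ solve (ℤ.+ p) (sumFin n (λ i → legendre p (curve b (suc (toℕ i))))) ⟩
      ℤ.- sumFin n (λ i → legendre p (curve b (suc (toℕ i)))) ∎
      where
      open ≡-Reasoning
      on-curve : ℕ → ℕ → Bool
      on-curve x y = does (y * y % p ≟ curve b x % p)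
      solve : ∀ p s → p ℤ.- (p ℤ.+ (ℤ.0ℤ ℤ.+ s)) ≡ ℤ.- s
      solve = ℤ.solve-∀

    curve-% : ∀ b a → legendre p (curve b (a % p)) ≡ legendre p (curve b a)
    curve-% b a = legendre-cong (curve b (a % p)) (curve b a)
      (≋-* (a % p) a ((a % p) ^ (2 * k) + b) (a ^ (2 * k) + b) (≋-% a)
        (≋-+ ((a % p) ^ (2 * k)) (a ^ (2 * k)) b b (≋-^ (a % p) a (2 * k) (≋-% a)) refl))

    -- At x = g ^ i the outer factor x gives the sign, and x ^ 2k is h ^ 2i, so the other factor is
    -- an entry of `M` in an even column.
    curve-power : ∀ e i → legendre p (curve (g ^ (k * e)) (g ^ i)) ≡ sign i ℤ.* M e (i * 2)
    curve-power e i = begin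
      legendre p (g ^ i * ((g ^ i) ^ (2 * k) + g ^ (k * e)))
        ≡⟨ legendre-power-* i ((g ^ i) ^ (2 * k) + g ^ (k * e)) ⟩
      sign i ℤ.* legendre p ((g ^ i) ^ (2 * k) + g ^ (k * e))
        ≡⟨ cong (λ a → sign i ℤ.* legendre p (a + g ^ (k * e))) (trans (^-*-assoc g i (2 * k)) (cong (g ^_) (regroup i k))) ⟩
      sign i ℤ.* legendre p (g ^ (k * (i * 2)) + g ^ (k * e))
        ≡⟨ cong (λ a → sign i ℤ.* legendre p a) (+-comm (g ^ (k * (i * 2))) (g ^ (k * e))) ⟩
      sign i ℤ.* M e (i * 2) ∎
      where
      open ≡-Reasoning
      regroup : ∀ i k → i * (2 * k) ≡ k * (i * 2)
      regroup = solve-∀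

    module _ (r-even : sign r ≡ ℤ.1ℤ) where
      -- Odd powers of 𝕚 have real part 0, and 𝕚 ^ 2i is the sign of i.
      gaussian-sum : ∀ e → sumFin m (λ j → re (toℕ j) ℤ.* M e (toℕ j)) ≡ sumFin r (λ i → sign (toℕ i) ℤ.* M e (toℕ i * 2))
      gaussian-sum e = trans (sumFin-pairs r (λ j → re j ℤ.* M e j)) (sumFin-cong r λ i → pair (toℕ i))
        where
        pair : ∀ i → re (i * 2) ℤ.* M e (i * 2) ℤ.+ re (suc (i * 2)) ℤ.* M e (suc (i * 2)) ≡ sign i ℤ.* M e (i * 2)
        pair i rewrite re-even i | im-even i = solve (sign i ℤ.* M e (i * 2)) (M e (suc (i * 2)))
          where
          solve : ∀ a b → a ℤ.+ ℤ.0ℤ ℤ.* b ≡ a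
          solve = ℤ.solve-∀

      -- For even r the summand at x = g ^ i has period r in i, since `sign r` is 1 and 2r = m. The
      -- n = 2kr exponents form 2k periods, the origin of 4k² in the theorem.
      affine-excess-power : ∀ e → ℤ.+ p ℤ.- ℤ.+ affinePoints p k (g ^ (k * e)) ≡
        ℤ.- (ℤ.+ k ℤ.* ℤ.+ 2 ℤ.* sumFin m (λ j → re (toℕ j) ℤ.* M e (toℕ j)))
      affine-excess-power e = trans (affine-excess (g ^ (k * e))) (cong ℤ.-_ (begin
        sumFin n (λ i → legendre p (curve (g ^ (k * e)) (suc (toℕ i))))
          ≡⟨ sum-nonzero (λ x → legendre p (curve (g ^ (k * e)) x)) (curve-% (g ^ (k * e))) ⟩
        sumFin n (λ i → legendre p (curve (g ^ (k * e)) (g ^ toℕ i)))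
          ≡⟨ sumFin-cong n (λ i → curve-power e (toℕ i)) ⟩
        sumFin n (λ i → T (toℕ i))
          ≡⟨ cong (λ n → sumFin n (λ i → T (toℕ i))) (trans n≡ (regroup k r)) ⟩
        sumFin (k * 2 * r) (λ i → T (toℕ i))
          ≡⟨ sumFin-periodic (k * 2) r T periodic ⟩
        ℤ.+ (k * 2) ℤ.* sumFin r (λ i → T (toℕ i))
          ≡⟨ cong₂ ℤ._*_ (ℤ.pos-* k 2) (sym (gaussian-sum e)) ⟩
        ℤ.+ k ℤ.* ℤ.+ 2 ℤ.* sumFin m (λ j → re (toℕ j) ℤ.* M e (toℕ j)) ∎))
        where
        open ≡-Reasoning
        open TwistedCirculant twisted
        T : ℕ → ℤ.ℤ
        T i = sign i ℤ.* M e (i * 2)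
        regroup : ∀ k r → k * (r * 2) ≡ k * 2 * r
        regroup = solve-∀
        shift-index : ∀ r i → (r + i) * 2 ≡ i * 2 + r * 2
        shift-index = solve-∀
        periodic : ∀ i → T (r + i) ≡ T i
        periodic i = cong₂ ℤ._*_
          (trans (sign-+ r i) (trans (cong (λ s → s ℤ.* sign i) r-even) (ℤ.*-identityˡ (sign i))))
          (trans (cong (M e) (shift-index r i)) (period e (i * 2)))

  -- Conclusion in the two residue classes modulo 4.

  module Conclusion (n : ℕ) (p-prime : Prime (suc n)) (g : ℕ) (primitiveRoot : IsPrimitiveRoot (suc n) g)
                    (l : ℕ) where
    p k : ℕ
    p = suc n
    k = suc (l * 2)

    det-W-1mod4 : ∀ w → n ≡ k * (suc w * 2 * 2) → ∃ λ z →
      ℤ.+ 4 ℤ.* ℤ.+ k ℤ.* ℤ.+ k ℤ.* det (dimW p k) (W p k) ≡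
      z ℤ.* z ℤ.* (cp p k ℤ.* cp p k ℤ.+ dp p k g ℤ.* dp p k g)
    det-W-1mod4 w n≡ =
      let z , eq = DoublyEven.det-even (w * 2) (sign-even w) twisted
      in z , (begin
        ℤ.+ 4 ℤ.* ℤ.+ k ℤ.* ℤ.+ k ℤ.* det (dimW p k) (W p k)
          ≡⟨ cong (λ d → ℤ.+ 4 ℤ.* ℤ.+ k ℤ.* ℤ.+ k ℤ.* d) (trans det-W eq) ⟩
        ℤ.+ 4 ℤ.* ℤ.+ k ℤ.* ℤ.+ k ℤ.* ((S 0 ℤ.* S 0 ℤ.+ S 1 ℤ.* S 1) ℤ.* (z ℤ.* z))
          ≡⟨ solve (ℤ.+ k) (S 0) (S 1) z ⟩
        z ℤ.* z ℤ.* (X 0 ℤ.* X 0 ℤ.+ X 1 ℤ.* X 1)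
          ≡⟨ cong₂ (λ c d → z ℤ.* z ℤ.* (c ℤ.* c ℤ.+ d ℤ.* d)) c≡ d≡ ⟨
        z ℤ.* z ℤ.* (cp p k ℤ.* cp p k ℤ.+ dp p k g ℤ.* dp p k g) ∎)
      where
      open ≡-Reasoning
      open KthPowers n p-prime g primitiveRoot l (suc w * 2) n≡ using (twisted; det-W; affine-excess-power)
      open DoublyEven (w * 2) (sign-even w) twisted using () renaming (Re to S)
      X : ℕ → ℤ.ℤ
      X e = ℤ.- (ℤ.+ k ℤ.* ℤ.+ 2 ℤ.* S e)
      solve : ∀ k a b z → ℤ.+ 4 ℤ.* k ℤ.* k ℤ.* ((a ℤ.* a ℤ.+ b ℤ.* b) ℤ.* (z ℤ.* z)) ≡
        z ℤ.* z ℤ.* ((ℤ.- (k ℤ.* ℤ.+ 2 ℤ.* a)) ℤ.* (ℤ.- (k ℤ.* ℤ.+ 2 ℤ.* a)) ℤ.+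
                     (ℤ.- (k ℤ.* ℤ.+ 2 ℤ.* b)) ℤ.* (ℤ.- (k ℤ.* ℤ.+ 2 ℤ.* b)))
      solve = ℤ.solve-∀
      -- The constants 1 and g ^ k of the two curves are g ^ (k e) for e = 0 and e = 1, so the
      -- curves correspond to rows 0 and 1 of the matrix.
      c≡ : cp p k ≡ X 0
      c≡ = trans (cong (λ e → ℤ.+ p ℤ.- ℤ.+ affinePoints p k (g ^ e)) (sym (*-zeroʳ k)))
        (affine-excess-power (sign-even (suc w)) 0)
      d≡ : dp p k g ≡ X 1
      d≡ = trans (cong (λ e → ℤ.+ p ℤ.- ℤ.+ affinePoints p k (g ^ e)) (sym (*-identityʳ k)))
        (affine-excess-power (sign-even (suc w)) 1)

    det-W-3mod4 : ∀ w → n ≡ k * (suc (w * 2) * 2) → ∃ λ z → ℤ.- det (dimW p k) (W p k) ≡ z ℤ.* z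
    det-W-3mod4 w n≡ =
      let z , eq = det-twisted-odd (w * 2) (sign-odd w) twisted
      in z , trans (cong ℤ.-_ det-W) eq
      where
      open KthPowers n p-prime g primitiveRoot l (suc (w * 2)) n≡ using (twisted; det-W)

  -- For odd m the prime km + 1 is even, hence equal to 2, although km ≥ k ≥ 2.
  cofactor-even : ∀ n l m → Prime (suc n) → 2 ≤ suc (l * 2) → n ≡ suc (l * 2) * m → ∃ λ r → m ≡ r * 2
  cofactor-even n l m p-prime 2≤k n≡km with even⊎odd m
  ... | inj₁ even       = even
  ... | inj₂ (q , refl) with prime⇒irreducible p-prime (divides (suc (q + l * suc (q * 2))) (trans (cong suc n≡km) (regroup l q)))
    where
    regroup : ∀ l q → suc (suc (l * 2) * suc (q * 2)) ≡ suc (q + l * suc (q * 2)) * 2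
    regroup = solve-∀
  ...   | inj₂ 2≡1+n = contradiction
    (≤-trans 2≤k (≤-trans (m≤m*n (suc (l * 2)) (suc (q * 2)))
      (≤-reflexive (trans (sym n≡km) (sym (suc-injective 2≡1+n))))))
    1+n≰n

  -- As k is odd, the parity of m / 2 decides p modulo 4. Writing `suc w` in the first case excludes
  -- m = 0, where p would be 1.
  data ModulusShape (n : ℕ) : ℕ → Set where
    1mod4 : ∀ l w → n ≡ suc (l * 2) * (suc w * 2 * 2)   → ModulusShape n (suc (l * 2))
    3mod4 : ∀ l w → n ≡ suc (l * 2) * (suc (w * 2) * 2) → ModulusShape n (suc (l * 2))

  modulus-shape : ∀ n k m → Prime (suc n) → 2 ≤ k → k % 2 ≡ 1 → suc n ≡ k * m + 1 → ModulusShape n k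
  modulus-shape n k m p-prime 2≤k k%2≡1 p≡km+1 with even⊎odd k
  ... | inj₁ (l , refl) = contradiction (trans (sym (m*n%n≡0 l 2)) k%2≡1) λ ()
  ... | inj₂ (l , refl) with cofactor-even n l m p-prime 2≤k n≡km
    where
    n≡km : n ≡ k * m
    n≡km = suc-injective (trans p≡km+1 (+-comm (k * m) 1))
  ...   | r , refl = halve (even⊎odd r)
    where
    n≡km : n ≡ k * (r * 2)
    n≡km = suc-injective (trans p≡km+1 (+-comm (k * (r * 2)) 1))
    halve : (∃ λ w → r ≡ w * 2) ⊎ (∃ λ w → r ≡ suc (w * 2)) → ModulusShape n k
    halve (inj₁ (zero  , refl)) = contradiction (subst (λ n → Prime (suc n)) (trans n≡km (*-zeroʳ (l * 2))) p-prime) ¬prime[1]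
    halve (inj₁ (suc w , refl)) = 1mod4 l w n≡km
    halve (inj₂ (w     , refl)) = 3mod4 l w n≡km

  shape-1mod4 : ∀ {n} l w → n ≡ suc (l * 2) * (suc w * 2 * 2) → suc n % 4 ≡ 1
  shape-1mod4 l w refl = trans (cong (λ n → suc n % 4) (regroup (suc (l * 2)) (suc w)))
    ([m+kn]%n≡m%n 1 (suc (l * 2) * suc w) 4)
    where
    regroup : ∀ k w → k * (w * 2 * 2) ≡ k * w * 4
    regroup = solve-∀

  shape-3mod4 : ∀ {n} l w → n ≡ suc (l * 2) * (suc (w * 2) * 2) → suc n % 4 ≡ 3
  shape-3mod4 l w refl = trans (cong (_% 4) (regroup l w)) ([m+kn]%n≡m%n 3 (l + w + l * w * 2) 4)
    where
    regroup : ∀ l w → suc (suc (l * 2) * (suc (w * 2) * 2)) ≡ 3 + (l + w + l * w * 2) * 4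
    regroup = solve-∀

open import Data.Nat using (ℕ; zero; suc; _≤_; _*_; _+_)
open import Data.Nat.DivMod using (_%_)
open import Data.Nat.Primality using (Prime; ¬prime[0])
open import Data.Integer as ℤ using (ℤ; +_; -_)
open import Data.Product using (_×_; _,_; ∃)
open import Relation.Nullary using (contradiction)
open import Relation.Binary.PropositionalEquality using (_≡_; sym; trans)
open LegendreMatrix using (modulus-shape; 1mod4; 3mod4; shape-1mod4; shape-3mod4; module Conclusion)

theorem1p2 : (p k m g : ℕ) → Prime p → 2 ≤ k → k % 2 ≡ 1 → p ≡ k * m + 1 → IsPrimitiveRoot p g →
    ((p % 4 ≡ 1 → ∃ λ (z : ℤ) → (+ 4) ℤ.* (+ k) ℤ.* (+ k) ℤ.* det (dimW p k) (W p k)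
    ≡ z ℤ.* z ℤ.* (cp p k ℤ.* cp p k ℤ.+ dp p k g ℤ.* dp p k g))
    × (p % 4 ≡ 3 → ∃ λ (z : ℤ) → ℤ.- det (dimW p k) (W p k) ≡ z ℤ.* z))
theorem1p2 zero    k m g p-prime = contradiction p-prime ¬prime[0]
theorem1p2 (suc n) k m g p-prime 2≤k k%2≡1 p≡km+1 primitiveRoot
  with modulus-shape n k m p-prime 2≤k k%2≡1 p≡km+1
... | 1mod4 l w n≡ =
  (λ _ → Conclusion.det-W-1mod4 n p-prime g primitiveRoot l w n≡) ,
  (λ p%4≡3 → contradiction (trans (sym (shape-1mod4 l w n≡)) p%4≡3) λ ())
... | 3mod4 l w n≡ =
  (λ p%4≡1 → contradiction (trans (sym (shape-3mod4 l w n≡)) p%4≡1) λ ()) ,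
  (λ _ → Conclusion.det-W-3mod4 n p-prime g primitiveRoot l w n≡)
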